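{- Let $G_1,G_2$ be connected graphs and let $\phi:G_1\to G_2$ be a strongly line-proper morphism. Then, under the canonical identifications $\mathrm{Ult}(\mathfrak C(G_i))\cong\mathcal D_E(G_i)\cong\Omega(L(G_i))$ ($i=1,2$), the maps $\mathrm{Ult}(\mathfrak C(\phi))$ and $\Omega(L(\phi))$ are equal. Denote this common map by $\mathcal D_E(\phi):\mathcal D_E(G_1)\to\mathcal D_E(G_2)$. Explicitly: (a) $\mathcal D_E(\phi)$ maps a direction $\rho_v\in\mathcal D_E(G_1)$ given by an infinite degree vertex $v\in V(G_1)$ to the direction $\rho_{\phi(v)}\in\mathcal D_E(G_2)$ given by the vertex $\phi(v)\in V(G_2)$, which is also of infinite degree; (b) $\mathcal D_E(\phi)$ maps a direction $\rho_r\in\mathcal D_E(G_1)$ given by a ray $r\subset V(G_1)$ to the unique direction $\rho_{\phi(r)}\in\mathcal D_E(G_2)$ that always picks a connected component intersecting $\phi(r)\subset V(G_2)$, that is, the unique direction such that for every finite $F\subset E(G_2)$ the component $\rho_{\phi(r)}(F)$ of $G_2\setminus F$ contains a vertex of $\phi(r)$.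
   Context: Graphs are simple and undirected, possibly infinite. A graph homomorphism is a map of vertex sets sending adjacent vertices to adjacent vertices; a 1-complex morphism sends adjacent vertices either to adjacent vertices or to a single vertex. A ray is a one-way infinite path without repeated vertices. Line graph. $L(G)$ has vertex set $E(G)$, two distinct edges being adjacent when they share a vertex. A graph homomorphism $\phi:G_1\to G_2$ induces the 1-complex morphism $L(\phi):L(G_1)\to L(G_2)$, $L(\phi)(\{u,v\})=\{\phi(u),\phi(v)\}$. A strongly line-proper morphism is a graph homomorphism $\phi$ such that $L(\phi)^{ -1}(e)$ is finite for every $e\in E(G_2)$. Strongly proper. $U\subset V(H)$ is dispersed if for every ray $r$ of $H$ there is a finite $F\subset V(H)$ such that the component of $H\setminus F$ containing a tail of $r$ is disjoint from $U$. A 1-complex morphism $\psi:H_1\to H_2$ is strongly proper if all fibers $\psi^{ -1}(v)$ are dispersed. If $\phi$ is strongly line-proper (between connected graphs) then $L(\phi)$ is strongly proper. Ends. Two rays of $H$ are equivalent if there are infinitely many pairwise disjoint (possibly trivial) paths joining them; $\Omega(H)$ is the set of equivalence classes (ends). For finite $F\subset V(H)$, $C(F,\varepsilon)$ is the component of $H\setminus F$ containing tails of all rays in $\varepsilon$; the sets $\{\eta : C(F,\eta)=C(F,\varepsilon)\}$ form a basis of the topology. For a strongly proper $\psi:H_1\to H_2$, the map $\Omega(\psi):\Omega(H_1)\to\Omega(H_2)$ sends $[r]$ to $[s]$, where $s$ is any ray contained in $\psi(r)$; it is well defined and continuous, and $\Omega(\psi)([r])$ is the only end of $H_2$ that cannot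 be separated from $\psi(r)$ by deleting finitely many vertices. Cut algebra. $\mathfrak c(G)$ is the Boolean algebra of sets $A\subset V(G)$ joined to their complement by only finitely many edges; $I_G$ is the ideal of finite sets of vertices of finite degree; $\mathfrak C(G)=\mathfrak c(G)/I_G$. For $\phi$ strongly line-proper, $\mathfrak C(\phi):\mathfrak C(G_2)\to\mathfrak C(G_1)$ is the well-defined homomorphism $A\mapsto\phi^{ -1}(A)$. $\mathrm{Ult}(\mathfrak B)$ is the set of ultrafilters of $\mathfrak B$ with basic open sets $\{u : B\in u\}$, and for a homomorphism $h:\mathfrak B_1\to\mathfrak B_2$, $\mathrm{Ult}(h):\mathrm{Ult}(\mathfrak B_2)\to\mathrm{Ult}(\mathfrak B_1)$ is $u\mapsto h^{ -1}[u]$. Edge-directions. For finite $F\subset E(G)$ let $\mathcal S^E_F$ be the set of infinite components of $G\setminus F$ (edges of $F$ deleted). $\mathcal D_E(G)$ is the set of functions $\rho$ with $\rho(F)\in\mathcal S^E_F$ for all finite $F\subset E(G)$ and $\rho(F')\subset\rho(F)$ whenever $F\subset F'$, with basic open sets $\{\rho' : \rho'(F)=\rho(F)\}$. For a vertex $v$ of infinite degree, $\rho_v(F)$ is the component of $G\setminus F$ containing $v$; for a ray $r$, $\rho_r(F)$ is the component of $G\setminus F$ containing a tail of $r$. Every edge-direction is given by an infinite degree vertex or by a ray in this way. Identifications, for $G$ connected. $\mathrm{Ult}(\mathfrak C(G))\cong\mathcal D_E(G)$ sends $u$ to $\rho_u$, where $\rho_u(F)$ is the unique component of $G\setminus F$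 whose vertex set represents an element of $u$. $\Omega(L(G))\cong\mathcal D_E(G)$ sends an end $\varepsilon$ of $L(G)$ to the direction $\rho_\varepsilon$ such that, for finite $F\subset E(G)=V(L(G))$, $\rho_\varepsilon(F)$ is the component of $G\setminus F$ whose edge set is the vertex set of $C(F,\varepsilon)$. Both are homeomorphisms.
   Formalization: In (b), the direction is characterized as the unique one whose component, for every finite F, contains a vertex of φ of every tail of r; with φ(r) alone uniqueness fails when the ray passes through an infinite-degree vertex. -}

module Defs where

open import Algebra.Lattice.Bundles using (BooleanAlgebra)
open import Algebra.Lattice.Morphism.Structures using (module LatticeMorphisms)
open import Axiom.ExcludedMiddle using (ExcludedMiddle)
open import Data.Empty using (⊥; ⊥-elim)
open import Data.List.Base using (List; []; _∷_; _++_; map; concatMap; upTo)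
open import Data.List.Relation.Unary.All using ([]; _∷_)
open import Data.List.Relation.Unary.Any using (Any; here; there)
open import Data.List.Relation.Unary.AllPairs using ([]; _∷_)
open import Data.Nat.Base using (ℕ; zero; suc; _+_; _∸_; _≤_; _<_; _⊔_; z≤n; s≤s)
open import Data.Product.Base using (Σ-syntax; ∃; _×_; _,_; proj₁; proj₂)
open import Data.Sum.Base using (_⊎_; inj₁; inj₂; swap; [_,_]′)
open import Data.Unit.Base using (⊤)
open import Function.Base using (_∘_; id; case_of_)
open import Function.Bundles using (Func; Inverse)
open import Function.Properties.Bijection using (Bijection⇒Inverse)
open import Level using (Level; Lift; lift) renaming (suc to lsuc; _⊔_ to _l⊔_)
open import Relation.Binary.Bundles using (Setoid)
open import Relation.Binary.Core using (Rel)
open import Relation.Binary.Definitions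
  using (Symmetric; Irreflexive; _Respects_; _Respects₂_; tri<; tri≈; tri>)
open import Relation.Binary.PropositionalEquality.Core as ≡ using (_≡_; _≢_)
open import Relation.Nullary using (¬_; yes; no)
open import Relation.Unary using (Pred; _⊆_; _≐_)

import Data.List.Membership.Setoid as Membership
import Data.List.Membership.Setoid.Properties as Membershipₚ
import Data.List.Membership.Propositional.Properties as Membership≡ₚ
import Data.List.Relation.Binary.Disjoint.Setoid as Disjointness
import Data.List.Relation.Unary.Any as Any
import Data.List.Relation.Unary.Any.Properties as Anyₚ
import Data.List.Relation.Unary.Unique.Setoid as Uniqueness
import Data.Nat.Properties as ℕₚ

-- Subsets need not be decidable here, so "finite" means contained (up to
-- the setoid equality) in a list.

module Finiteness {c ℓ} (S : Setoid c ℓ) where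
  open Setoid S using () renaming (Carrier to A)
  open Membership S using (_∈_)

  Finite Infinite : ∀ {p} → Pred A p → Set (c l⊔ ℓ l⊔ p)
  Finite P   = Σ[ xs ∈ List A ] (∀ {x} → P x → x ∈ xs)
  Infinite P = ¬ Finite P

Eventually : ∀ {p} → Pred ℕ p → Set p
Eventually P = Σ[ N ∈ ℕ ] (∀ n → N ≤ n → P n)

-- Vertices form a setoid, so that the vertices of a line graph can be
-- unordered pairs.

record Graph (ℓ : Level) : Set (lsuc ℓ) where
  infix 4 _~_
  field
    vertexSetoid : Setoid ℓ ℓ

  open Setoid vertexSetoid public
    using (_≈_)
    renaming (Carrier to V; refl to ≈-refl; sym to ≈-sym; trans to ≈-trans)

  field
    _~_      : Rel V ℓ
    ~-resp   : _~_ Respects₂ _≈_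
    ~-sym    : Symmetric _~_
    ~-irrefl : Irreflexive _≈_ _~_

  open Membership vertexSetoid public using (_∈_; _∉_)
  open Finiteness vertexSetoid public using (Finite; Infinite)
  open Uniqueness vertexSetoid public using (Unique)
  open Disjointness vertexSetoid public using (Disjoint)

module _ {ℓ} (G : Graph ℓ) where
  open Graph G

  record Edge : Set ℓ where
    constructor edge
    field
      {src tgt} : V
      adj       : src ~ tgt

  open Edge

  infix 4 _∈ᵉ_ _≈ᵉ_
  data _∈ᵉ_ (v : V) (e : Edge) : Set ℓ where
    at-src : v ≈ src e → v ∈ᵉ e
    at-tgt : v ≈ tgt e → v ∈ᵉ e

  -- Equality of unordered pairs.
  data _≈ᵉ_ (e f : Edge) : Set ℓ where
    same : src e ≈ src f → tgt e ≈ tgt f → e ≈ᵉ f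
    flip : src e ≈ tgt f → tgt e ≈ src f → e ≈ᵉ f

  ≈ᵉ-refl : ∀ {e} → e ≈ᵉ e
  ≈ᵉ-refl = same ≈-refl ≈-refl

  ≈ᵉ-sym : ∀ {e f} → e ≈ᵉ f → f ≈ᵉ e
  ≈ᵉ-sym (same p q) = same (≈-sym p) (≈-sym q)
  ≈ᵉ-sym (flip p q) = flip (≈-sym q) (≈-sym p)

  ≈ᵉ-trans : ∀ {e f g} → e ≈ᵉ f → f ≈ᵉ g → e ≈ᵉ g
  ≈ᵉ-trans (same p q) (same r s) = same (≈-trans p r) (≈-trans q s)
  ≈ᵉ-trans (same p q) (flip r s) = flip (≈-trans p r) (≈-trans q s)
  ≈ᵉ-trans (flip p q) (same r s) = flip (≈-trans p s) (≈-trans q r)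
  ≈ᵉ-trans (flip p q) (flip r s) = same (≈-trans p s) (≈-trans q r)

  edgeSetoid : Setoid ℓ ℓ
  edgeSetoid = record
    { Carrier       = Edge
    ; _≈_           = _≈ᵉ_
    ; isEquivalence = record { refl = ≈ᵉ-refl ; sym = ≈ᵉ-sym ; trans = ≈ᵉ-trans }
    }

  ∈ᵉ-respʳ : ∀ {v e f} → e ≈ᵉ f → v ∈ᵉ e → v ∈ᵉ f
  ∈ᵉ-respʳ (same p q) (at-src r) = at-src (≈-trans r p)
  ∈ᵉ-respʳ (same p q) (at-tgt r) = at-tgt (≈-trans r q)
  ∈ᵉ-respʳ (flip p q) (at-src r) = at-tgt (≈-trans r p)
  ∈ᵉ-respʳ (flip p q) (at-tgt r) = at-src (≈-trans r q)

  ∈ᵉ-respˡ : ∀ {v w e} → v ≈ w → v ∈ᵉ e → w ∈ᵉ e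
  ∈ᵉ-respˡ p (at-src q) = at-src (≈-trans (≈-sym p) q)
  ∈ᵉ-respˡ p (at-tgt q) = at-tgt (≈-trans (≈-sym p) q)

  LineGraph : Graph ℓ
  LineGraph = record
    { vertexSetoid = edgeSetoid
    ; _~_          = λ e f → ¬ (e ≈ᵉ f) × Σ[ v ∈ V ] (v ∈ᵉ e × v ∈ᵉ f)
    ; ~-resp       =
        (λ f≈f′ (e≉f , v , v∈e , v∈f) →
          (λ e≈f′ → e≉f (≈ᵉ-trans e≈f′ (≈ᵉ-sym f≈f′))) , v , v∈e , ∈ᵉ-respʳ f≈f′ v∈f) ,
        (λ e≈e′ (e≉f , v , v∈e , v∈f) →
          (λ e′≈f → e≉f (≈ᵉ-trans e≈e′ e′≈f)) , v , ∈ᵉ-respʳ e≈e′ v∈e , v∈f)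
    ; ~-sym        = λ (e≉f , v , v∈e , v∈f) → (λ f≈e → e≉f (≈ᵉ-sym f≈e)) , v , v∈f , v∈e
    ; ~-irrefl     = λ e≈f (e≉f , _) → e≉f e≈f
    }

  FiniteDegree InfiniteDegree : V → Set ℓ
  FiniteDegree v   = Graph.Finite LineGraph (v ∈ᵉ_)
  InfiniteDegree v = Graph.Infinite LineGraph (v ∈ᵉ_)

record Subgraph {ℓ} (G : Graph ℓ) : Set (lsuc ℓ) where
  private module G = Graph G
  infix 4 _~_
  field
    Vertex      : Pred G.V ℓ
    _~_         : Rel G.V ℓ
    Vertex-resp : Vertex Respects G._≈_
    ~-resp      : _~_ Respects₂ G._≈_
    ~-sym       : Symmetric _~_
    ~⇒adj       : ∀ {x y} → x ~ y → x G.~ y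
    ~⇒Vertex    : ∀ {x y} → x ~ y → Vertex x

module _ {ℓ} (G : Graph ℓ) where
  open Graph G

  whole : Subgraph G
  whole = record
    { Vertex      = λ _ → Lift ℓ ⊤
    ; _~_         = _~_
    ; Vertex-resp = λ _ v → v
    ; ~-resp      = ~-resp
    ; ~-sym       = ~-sym
    ; ~⇒adj       = id
    ; ~⇒Vertex    = _
    }

infixl 6 _∖ᵛ_ _∖ᵉ_

_∖ᵛ_ : ∀ {ℓ} (H : Graph ℓ) → List (Graph.V H) → Subgraph H
H ∖ᵛ F = record
  { Vertex      = _∉ F
  ; _~_         = λ x y → x ~ y × x ∉ F × y ∉ F
  ; Vertex-resp = ∉-resp
  ; ~-resp      = (λ y≈z (a , x∉F , y∉F) → proj₁ ~-resp y≈z a , x∉F , ∉-resp y≈z y∉F) ,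
                  (λ x≈z (a , x∉F , y∉F) → proj₂ ~-resp x≈z a , ∉-resp x≈z x∉F , y∉F)
  ; ~-sym       = λ (a , x∉F , y∉F) → ~-sym a , y∉F , x∉F
  ; ~⇒adj       = proj₁
  ; ~⇒Vertex    = proj₁ ∘ proj₂
  }
  where
  open Graph H
  ∉-resp : (_∉ F) Respects _≈_
  ∉-resp = Membershipₚ.∉-resp-≈ vertexSetoid

_∖ᵉ_ : ∀ {ℓ} (G : Graph ℓ) → List (Edge G) → Subgraph G
G ∖ᵉ F = record
  { Vertex      = λ _ → Lift _ ⊤
  ; _~_         = λ x y → Σ[ a ∈ x ~ y ] edge a ∉ᵉ F
  ; Vertex-resp = λ _ v → v
  ; ~-resp      = (λ y≈z (a , e∉F) → proj₁ ~-resp y≈z a , ∉-resp (same ≈-refl y≈z) e∉F) ,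
                  (λ x≈z (a , e∉F) → proj₂ ~-resp x≈z a , ∉-resp (same x≈z ≈-refl) e∉F)
  ; ~-sym       = λ (a , e∉F) → ~-sym a , ∉-resp (flip ≈-refl ≈-refl) e∉F
  ; ~⇒adj       = proj₁
  ; ~⇒Vertex    = _
  }
  where
  open Graph G
  open Graph (LineGraph G) using () renaming (_∉_ to _∉ᵉ_; _≈_ to _≈ˡ_)
  ∉-resp : ∀ {e f} → e ≈ˡ f → e ∉ᵉ F → f ∉ᵉ F
  ∉-resp = Membershipₚ.∉-resp-≈ (edgeSetoid G)

module _ {ℓ} {G : Graph ℓ} where
  open Graph G

  data Walk (S : Subgraph G) : V → V → Set ℓ where
    stop : ∀ {x y} → Subgraph.Vertex S x → x ≈ y → Walk S x y
    step : ∀ {x y z} → Subgraph._~_ S x y → Walk S y z → Walk S x z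

  support : ∀ {S x y} → Walk S x y → List V
  support {x = x} (stop _ _) = x ∷ []
  support {x = x} (step _ w) = x ∷ support w

  IsComponent : Subgraph G → Pred V ℓ → Set ℓ
  IsComponent S C = Σ[ x ∈ V ] (Subgraph.Vertex S x × C ≐ Walk S x)

Connected : ∀ {ℓ} → Graph ℓ → Set ℓ
Connected G = ∀ x y → Walk (whole G) x y

record Ray {ℓ} (H : Graph ℓ) : Set ℓ where
  open Graph H
  field
    at       : ℕ → V
    at-adj   : ∀ n → at n ~ at (suc n)
    distinct : ∀ {m n} → at m ≈ at n → m ≡ n

module _ {ℓ} {H : Graph ℓ} where
  open Graph H
  open Ray

  drop : ℕ → Ray H → Ray H
  drop k r = record
    { at       = λ n → at r (k + n)
    ; at-adj   = λ n → ≡.subst (λ i → at r (k + n) ~ at r i) (≡.sym (ℕₚ.+-suc k n)) (at-adj r (k + n))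
    ; distinct = λ {m} {n} p → ℕₚ.+-cancelˡ-≡ k m n (distinct r p)
    }

  -- The component of S that contains a tail of r (empty if there is none).
  tailComponent : Subgraph H → Ray H → Pred V ℓ
  tailComponent S r y = Eventually (λ n → Walk S (at r n) y)

  record JoiningPath (r s : Ray H) : Set ℓ where
    field
      {start end} : V
      walk        : Walk (whole H) start end
      unique      : Unique (support walk)
      start∈r     : Σ[ m ∈ ℕ ] start ≈ at r m
      end∈s       : Σ[ n ∈ ℕ ] end ≈ at s n

  open JoiningPath

  infix 4 _∼_
  _∼_ : Rel (Ray H) ℓ
  r ∼ s = Σ[ P ∈ (ℕ → JoiningPath r s) ]
            (∀ {m n} → m ≢ n → Disjoint (support (walk (P m))) (support (walk (P n))))

  Dispersed : Pred V ℓ → Set ℓ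
  Dispersed U = ∀ r → Σ[ F ∈ List V ] (∀ {y} → tailComponent (H ∖ᵛ F) r y → ¬ U y)

record Hom {ℓ} (G₁ G₂ : Graph ℓ) : Set ℓ where
  private module G₁ = Graph G₁
  private module G₂ = Graph G₂
  field
    func     : Func G₁.vertexSetoid G₂.vertexSetoid
    preserve : ∀ {x y} → x G₁.~ y → Func.to func x G₂.~ Func.to func y

  open Func func public

record ComplexMorphism {ℓ} (H₁ H₂ : Graph ℓ) : Set ℓ where
  private module H₁ = Graph H₁
  private module H₂ = Graph H₂
  field
    func     : Func H₁.vertexSetoid H₂.vertexSetoid

  open Func func public

  field
    preserve : ∀ {x y} → x H₁.~ y → to x H₂.~ to y ⊎ to x H₂.≈ to y

StronglyProper : ∀ {ℓ} {H₁ H₂ : Graph ℓ} → ComplexMorphism H₁ H₂ → Set ℓ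
StronglyProper {H₁ = H₁} {H₂} ψ =
  ∀ v → Dispersed {H = H₁} (λ x → Graph._≈_ H₂ (ComplexMorphism.to ψ x) v)

module _ {ℓ} {G₁ G₂ : Graph ℓ} where
  private module L₂ = Graph (LineGraph G₂)

  lineFunc : Hom G₁ G₂ → Func (edgeSetoid G₁) (edgeSetoid G₂)
  lineFunc φ = record
    { to   = λ e → edge (preserve (Edge.adj e))
    ; cong = λ where
        (same p q) → same (cong p) (cong q)
        (flip p q) → flip (cong p) (cong q)
    }
    where open Hom φ

  StronglyLineProper : Hom G₁ G₂ → Set ℓ
  StronglyLineProper φ =
    ∀ e → Graph.Finite (LineGraph G₁) (λ f → Func.to (lineFunc φ) f L₂.≈ e)

record Direction {ℓ} (G : Graph ℓ) : Set (lsuc ℓ) where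
  open Graph G
  open Graph (LineGraph G) using () renaming (_∈_ to _∈ˡ_)
  field
    comp        : List (Edge G) → Pred V ℓ
    isComponent : ∀ F → IsComponent (G ∖ᵉ F) (comp F)
    isInfinite  : ∀ F → Infinite (comp F)
    monotone    : ∀ {F F′} → (∀ {e} → e ∈ˡ F → e ∈ˡ F′) → comp F′ ⊆ comp F

𝒟ᴱ : ∀ {ℓ} → Graph ℓ → Setoid (lsuc ℓ) ℓ
𝒟ᴱ G = record
  { Carrier       = Direction G
  ; _≈_           = λ ρ ρ′ → ∀ F → comp ρ F ≐ comp ρ′ F
  ; isEquivalence = record
    { refl  = λ F → id , id
    ; sym   = λ p F → proj₂ (p F) , proj₁ (p F)
    ; trans = λ p q F → proj₁ (q F) ∘ proj₁ (p F) , proj₂ (p F) ∘ proj₂ (q F)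
    }
  }
  where open Direction

-- Even when w enumerates a ray this need not determine ρ: the ray may pass
-- through an infinite-degree vertex v, and then ρ-vertex v has the property
-- too. Asking for it along all tails of w excludes this.
AlwaysIntersects : ∀ {ℓ} {G : Graph ℓ} → (ℕ → Graph.V G) → Direction G → Set ℓ
AlwaysIntersects w ρ = ∀ F → Σ[ n ∈ ℕ ] Direction.comp ρ F (w n)

record BooleanHom {c ℓ} (B₁ B₂ : BooleanAlgebra c ℓ) : Set (c l⊔ ℓ) where
  private module B₁ = BooleanAlgebra B₁
  private module B₂ = BooleanAlgebra B₂
  open LatticeMorphisms B₁.rawLattice B₂.rawLattice using (IsLatticeHomomorphism)
  field
    ⟦_⟧                   : B₁.Carrier → B₂.Carrier
    isLatticeHomomorphism : IsLatticeHomomorphism ⟦_⟧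
    ¬-homo                : ∀ a → ⟦ B₁.¬ a ⟧ B₂.≈ B₂.¬ ⟦ a ⟧
    ⊤-homo                : ⟦ B₁.⊤ ⟧ B₂.≈ B₂.⊤
    ⊥-homo                : ⟦ B₁.⊥ ⟧ B₂.≈ B₂.⊥

  open IsLatticeHomomorphism isLatticeHomomorphism public

record Ultrafilter {c ℓ} (B : BooleanAlgebra c ℓ) : Set (c l⊔ lsuc ℓ) where
  open BooleanAlgebra B renaming (¬_ to ∁_; ⊤ to 𝟙; ⊥ to 𝟘)
  -- The level of mem is no restriction under excluded middle, by which every
  -- predicate is equivalent to one at level ℓ.
  field
    mem       : Pred Carrier ℓ
    𝟙-mem     : mem 𝟙
    𝟘-nonmem  : ¬ mem 𝟘
    ∧-closed  : ∀ {a b} → mem a → mem b → mem (a ∧ b)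
    up-closed : ∀ {a b} → a ∧ b ≈ a → mem a → mem b
    ultra     : ∀ a → mem a ⊎ mem (∁ a)

Ult : ∀ {c ℓ} → BooleanAlgebra c ℓ → Setoid (c l⊔ lsuc ℓ) (c l⊔ ℓ)
Ult B = record
  { Carrier       = Ultrafilter B
  ; _≈_           = λ u u′ → mem u ≐ mem u′
  ; isEquivalence = record
    { refl  = id , id
    ; sym   = λ (p , q) → q , p
    ; trans = λ (p , q) (p′ , q′) → p′ ∘ p , q ∘ q′
    }
  }
  where open Ultrafilter

module _ {c ℓ} {B₁ B₂ : BooleanAlgebra c ℓ} where
  private module B₁ = BooleanAlgebra B₁
  private module B₂ = BooleanAlgebra B₂
  open Ultrafilter

  mem-resp : (u : Ultrafilter B₂) → mem u Respects B₂._≈_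
  mem-resp u a≈b = up-closed u (B₂.trans (B₂.∧-congˡ (B₂.sym a≈b)) (∧-idem _))
    where
    open import Algebra.Lattice.Properties.Lattice B₂.lattice using (∧-idem)

  Ult-map : BooleanHom B₁ B₂ → Func (Ult B₂) (Ult B₁)
  Ult-map h = record
    { to   = λ u → record
      { mem       = λ a → mem u ⟦ a ⟧
      ; 𝟙-mem     = mem-resp u (B₂.sym ⊤-homo) (𝟙-mem u)
      ; 𝟘-nonmem  = λ m → 𝟘-nonmem u (mem-resp u ⊥-homo m)
      ; ∧-closed  = λ m n → mem-resp u (B₂.sym (∧-homo _ _)) (∧-closed u m n)
      ; up-closed = λ p → up-closed u (B₂.trans (B₂.sym (∧-homo _ _)) (⟦⟧-cong p))
      ; ultra     = λ a → [ inj₁ , (λ m → inj₂ (mem-resp u (B₂.sym (¬-homo a)) m)) ]′ (ultra u ⟦ a ⟧)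
      }
    ; cong = λ (p , q) → p , q
    }
    where open BooleanHom h

_△_ : ∀ {ℓ} {X : Set ℓ} → Pred X ℓ → Pred X ℓ → Pred X ℓ
(A △ B) v = (A v × ¬ B v) ⊎ (B v × ¬ A v)

module _ {ℓ} (G : Graph ℓ) where
  open Graph G
  private module L = Graph (LineGraph G)

  Crosses : Pred V ℓ → Pred (Edge G) ℓ
  Crosses A e = (A (Edge.src e) × ¬ A (Edge.tgt e)) ⊎ (A (Edge.tgt e) × ¬ A (Edge.src e))

  record Cut : Set (lsuc ℓ) where
    field
      set      : Pred V ℓ
      set-resp : set Respects _≈_
      boundary : L.Finite (Crosses set)

  -- Membership in the ideal by which cuts are identified in ℭ.
  Negligible : Pred V ℓ → Set ℓ
  Negligible A = Finite A × (∀ {v} → A v → FiniteDegree G v)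

Eventually-× : ∀ {p q} {P : Pred ℕ p} {Q : Pred ℕ q} →
               Eventually P → Eventually Q → Eventually (λ n → P n × Q n)
Eventually-× (M , p) (N , q) = M ⊔ N , λ n M⊔N≤n →
  p n (ℕₚ.≤-trans (ℕₚ.m≤m⊔n M N) M⊔N≤n) , q n (ℕₚ.≤-trans (ℕₚ.m≤n⊔m M N) M⊔N≤n)

Eventually-map : ∀ {p q} {P : Pred ℕ p} {Q : Pred ℕ q} →
                 (∀ {n} → P n → Q n) → Eventually P → Eventually Q
Eventually-map f (N , p) = N , λ n N≤n → f (p n N≤n)

module _ {ℓ} {G : Graph ℓ} where
  open Graph G

  module _ {S : Subgraph G} where
    private module S = Subgraph S

    walk-start : ∀ {x y} → Walk S x y → S.Vertex x
    walk-start (stop v _) = v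
    walk-start (step a _) = S.~⇒Vertex a

    walk-respˡ : ∀ {x x′ y} → x ≈ x′ → Walk S x y → Walk S x′ y
    walk-respˡ p (stop v q) = stop (S.Vertex-resp p v) (≈-trans (≈-sym p) q)
    walk-respˡ p (step a w) = step (proj₂ S.~-resp p a) w

    walk-respʳ : ∀ {x y y′} → y ≈ y′ → Walk S x y → Walk S x y′
    walk-respʳ p (stop v q) = stop v (≈-trans q p)
    walk-respʳ p (step a w) = step a (walk-respʳ p w)

    infixr 5 _◅◅_
    _◅◅_ : ∀ {x y z} → Walk S x y → Walk S y z → Walk S x z
    stop _ p ◅◅ w = walk-respˡ (≈-sym p) w
    step a v ◅◅ w = step a (v ◅◅ w)

    reverse : ∀ {x y} → Walk S x y → Walk S y x
    reverse (stop v p) = stop (S.Vertex-resp p v) (≈-sym p)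
    reverse (step a w) = reverse w ◅◅ step (S.~-sym a) (stop (S.~⇒Vertex a) ≈-refl)

    walk-end : ∀ {x y} → Walk S x y → S.Vertex y
    walk-end = walk-start ∘ reverse

    lazy-step : ∀ {x y} → S.Vertex x → (x S.~ y) ⊎ (x ≈ y) → Walk S x y
    lazy-step v (inj₁ a) = step a (stop (S.~⇒Vertex (S.~-sym a)) ≈-refl)
    lazy-step v (inj₂ p) = stop v p

    end∈support : ∀ {x y} (w : Walk S x y) → y ∈ support w
    end∈support (stop _ p) = here (≈-sym p)
    end∈support (step _ w) = there (end∈support w)

    start∈support : ∀ {x y} (w : Walk S x y) → x ∈ support w
    start∈support (stop _ _) = here ≈-refl
    start∈support (step _ _) = here ≈-refl

    component-walk : ∀ {C x y} → IsComponent S C → C x → C y → Walk S x y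
    component-walk (z , _ , C⊆ , _) Cx Cy = reverse (C⊆ Cx) ◅◅ C⊆ Cy

    component-closed : ∀ {C x y} → IsComponent S C → C x → Walk S x y → C y
    component-closed (z , _ , C⊆ , ⊆C) Cx w = ⊆C (C⊆ Cx ◅◅ w)

    component-Vertex : ∀ {C x} → IsComponent S C → C x → S.Vertex x
    component-Vertex (z , _ , C⊆ , _) Cx = walk-end (C⊆ Cx)

    components-≐ : ∀ {C D x} → IsComponent S C → IsComponent S D → C x → D x → C ≐ D
    components-≐ c d Cx Dx =
      (λ Cy → component-closed d Dx (component-walk c Cx Cy)) ,
      (λ Dy → component-closed c Cx (component-walk d Dx Dy))

    component-≐ : ∀ {C x} → IsComponent S C → C x → C ≐ Walk S x
    component-≐ c Cx = component-walk c Cx , component-closed c Cx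

    component-inhabited : ∀ {C} → IsComponent S C → Σ[ x ∈ V ] C x
    component-inhabited (x , v , _ , ⊆C) = x , ⊆C (stop v ≈-refl)

    walk-component : ∀ {x} → S.Vertex x → IsComponent S (Walk S x)
    walk-component v = _ , v , id , id

    tail-walk : (at : ℕ → V) (N : ℕ) →
                (∀ n → N ≤ n → S.Vertex (at n) × ((at n S.~ at (suc n)) ⊎ (at n ≈ at (suc n)))) →
                ∀ m n → N ≤ m → N ≤ n → Walk S (at m) (at n)
    tail-walk at N h m n N≤m N≤n with ℕₚ.≤-total m n
    ... | inj₁ m≤n = ≡.subst (λ i → Walk S (at m) (at i)) (ℕₚ.m∸n+n≡m m≤n) (go (n ∸ m) m N≤m)
      where
      go : ∀ k m → N ≤ m → Walk S (at m) (at (k + m))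
      go zero    m N≤m = stop (proj₁ (h m N≤m)) ≈-refl
      go (suc k) m N≤m = go k m N≤m ◅◅ lazy-step (proj₁ h′) (proj₂ h′)
        where h′ = h (k + m) (ℕₚ.≤-trans N≤m (ℕₚ.m≤n+m m k))
    ... | inj₂ n≤m = reverse (≡.subst (λ i → Walk S (at n) (at i)) (ℕₚ.m∸n+n≡m n≤m) (go (m ∸ n) n N≤n))
      where
      go : ∀ k m → N ≤ m → Walk S (at m) (at (k + m))
      go zero    m N≤m = stop (proj₁ (h m N≤m)) ≈-refl
      go (suc k) m N≤m = go k m N≤m ◅◅ lazy-step (proj₁ h′) (proj₂ h′)
        where h′ = h (k + m) (ℕₚ.≤-trans N≤m (ℕₚ.m≤n+m m k))

    tailComponent-≐ : ∀ {r : Ray G} N → (∀ m n → N ≤ m → N ≤ n → Walk S (Ray.at r m) (Ray.at r n)) →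
                      ∀ m → N ≤ m → tailComponent S r ≐ Walk S (Ray.at r m)
    tailComponent-≐ {r} N h m N≤m =
      (λ (M , p) → h m (M ⊔ N) N≤m (ℕₚ.m≤n⊔m M N) ◅◅ p (M ⊔ N) (ℕₚ.m≤m⊔n M N)) ,
      (λ w → N , λ n N≤n → h n m N≤n N≤m ◅◅ w)

  Walk-∖ᵛ-antitone : ∀ {F F′} → (∀ {x} → x ∈ F → x ∈ F′) →
                     ∀ {x y} → Walk (G ∖ᵛ F′) x y → Walk (G ∖ᵛ F) x y
  Walk-∖ᵛ-antitone F⊆F′ (stop x∉ p)            = stop (x∉ ∘ F⊆F′) p
  Walk-∖ᵛ-antitone F⊆F′ (step (a , x∉ , y∉) w) = step (a , x∉ ∘ F⊆F′ , y∉ ∘ F⊆F′) (Walk-∖ᵛ-antitone F⊆F′ w)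

  Walk-∖ᵉ-antitone : ∀ {F F′} → (∀ {e} → Graph._∈_ (LineGraph G) e F → Graph._∈_ (LineGraph G) e F′) →
                     ∀ {x y} → Walk (G ∖ᵉ F′) x y → Walk (G ∖ᵉ F) x y
  Walk-∖ᵉ-antitone F⊆F′ (stop v p)        = stop v p
  Walk-∖ᵉ-antitone F⊆F′ (step (a , e∉) w) = step (a , e∉ ∘ F⊆F′) (Walk-∖ᵉ-antitone F⊆F′ w)

  endpoints : List (Edge G) → List V
  endpoints []       = []
  endpoints (e ∷ es) = Edge.src e ∷ Edge.tgt e ∷ endpoints es

  ∈-endpoints : ∀ {v e es} → Graph._∈_ (LineGraph G) e es → _∈ᵉ_ G v e → v ∈ endpoints es
  ∈-endpoints (here p)  v∈e with ∈ᵉ-respʳ G p v∈e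
  ... | at-src q = here q
  ... | at-tgt q = there (here q)
  ∈-endpoints (there p) v∈e = there (there (∈-endpoints p v∈e))

mapWalk : ∀ {ℓ p} {G H : Graph ℓ} {S : Subgraph G} {T : Subgraph H}
          (f : Graph.V G → Graph.V H) (P : Pred (Graph.V G) p) →
          (∀ {x y} → P x → Subgraph._~_ S x y → P y) →
          (∀ {x y} → P x → Subgraph.Vertex S x → Graph._≈_ G x y → Walk T (f x) (f y)) →
          (∀ {x y} → P x → P y → Subgraph._~_ S x y → Walk T (f x) (f y)) →
          ∀ {x y} → P x → Walk S x y → Walk T (f x) (f y)
mapWalk f P cl onV onE px (stop v p) = onV px v p
mapWalk f P cl onV onE px (step a w) =
  onE px (cl px a) a ◅◅ mapWalk f P cl onV onE (cl px a) w

-- Excluded middle for all types, not only propositions, also yields the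
-- choices made below, such as that of a ray contained in an image.

module Classical {ℓ} (em : ExcludedMiddle ℓ) where

  dne : {A : Set ℓ} → ¬ ¬ A → A
  dne {A} ¬¬a with em {A}
  ... | yes a = a
  ... | no ¬a = ⊥-elim (¬¬a ¬a)

  ¬∀⟶∃¬ : {A : Set ℓ} {P : A → Set ℓ} → ¬ (∀ x → P x) → ∃ λ x → ¬ P x
  ¬∀⟶∃¬ ¬p = dne λ ¬∃ → ¬p λ x → dne λ ¬px → ¬∃ (x , ¬px)

  last-instance : (P : Pred ℕ ℓ) → Eventually (λ k → ¬ P k) → ∀ n → P n →
                  Σ[ m ∈ ℕ ] (n ≤ m × P m × (∀ k → m < k → ¬ P k))
  last-instance P (N , ¬p) n pn = go N n (ℕₚ.m≤m+n N n) pn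
    where
    go : ∀ d n → N ≤ d + n → P n → Σ[ m ∈ ℕ ] (n ≤ m × P m × (∀ k → m < k → ¬ P k))
    go zero    n N≤n pn = ⊥-elim (¬p n N≤n pn)
    go (suc d) n N≤  pn with em {Σ[ k ∈ ℕ ] (n < k × P k)}
    ... | no  none          = n , ℕₚ.≤-refl , pn , λ k n<k pk → none (k , n<k , pk)
    ... | yes (k , n<k , pk) =
      let m , k≤m , rest = go d k (ℕₚ.≤-trans N≤ (ℕₚ.≤-trans (ℕₚ.≤-reflexive (≡.sym (ℕₚ.+-suc d n))) (ℕₚ.+-monoʳ-≤ d n<k))) pk
      in m , ℕₚ.≤-trans (ℕₚ.<⇒≤ n<k) k≤m , rest

  module Sequences (S : Setoid ℓ ℓ) where
    open Setoid S renaming (Carrier to A)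
    open Membership S using (_∈_; _∉_)
    open Finiteness S

    LocallyFinite : (ℕ → A) → Set ℓ
    LocallyFinite w = ∀ x → Eventually (λ n → ¬ (w n ≈ x))

    eventually-∉ : ∀ {w} → LocallyFinite w → ∀ xs → Eventually (λ n → w n ∉ xs)
    eventually-∉ lf []       = 0 , λ _ _ ()
    eventually-∉ lf (x ∷ xs) = Eventually-map
      (λ { (p , q) (here e) → p e ; (p , q) (there e) → q e })
      (Eventually-× (lf x) (eventually-∉ lf xs))

    injective⇒LocallyFinite : ∀ {w} → (∀ {m n} → w m ≈ w n → m ≡ n) → LocallyFinite w
    injective⇒LocallyFinite {w} inj x with em {Σ[ n ∈ ℕ ] w n ≈ x}
    ... | no none      = 0 , λ n _ p → none (n , p)
    ... | yes (n , p) = suc n , λ m n<m q → ℕₚ.<⇒≢ n<m (inj (trans p (sym q)))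

    eventually-infinite : ∀ {p} {P : Pred A p} {w} → LocallyFinite w → Eventually (λ n → P (w n)) → Infinite P
    eventually-infinite lf ev (xs , P⊆xs) =
      let N , h = Eventually-× ev (eventually-∉ lf xs)
          p , q = h N ℕₚ.≤-refl
      in q (P⊆xs p)

    private
      module Enumerate {P : Pred A ℓ} (inf : Infinite P) where
        pick : ∀ xs → Σ[ x ∈ A ] (P x × x ∉ xs)
        pick xs = dne λ none → inf (xs , λ {x} px → dne λ x∉ → none (x , px , x∉))

        prefix : ℕ → List A
        prefix zero    = []
        prefix (suc n) = proj₁ (pick (prefix n)) ∷ prefix n

        seq : ℕ → A
        seq n = proj₁ (pick (prefix n))

        earlier : ∀ {m n} → m < n → seq m ∈ prefix n
        earlier {m} {suc n} (s≤s m≤n) with ℕₚ.m≤n⇒m<n∨m≡n m≤n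
        ... | inj₁ m<n    = there (earlier m<n)
        ... | inj₂ ≡.refl = here refl

        distinct : ∀ {m n} → m < n → ¬ (seq m ≈ seq n)
        distinct {m} {n} m<n p =
          proj₂ (proj₂ (pick (prefix n))) (Membershipₚ.∈-resp-≈ S p (earlier m<n))

    enumerate : ∀ {P : Pred A ℓ} → Infinite P →
                Σ[ w ∈ (ℕ → A) ] ((∀ n → P (w n)) × (∀ {m n} → w m ≈ w n → m ≡ n))
    enumerate inf = seq , (λ n → proj₁ (proj₂ (pick (prefix n)))) , inj
      where
      open Enumerate inf
      inj : ∀ {m n} → seq m ≈ seq n → m ≡ n
      inj {m} {n} p with ℕₚ.<-cmp m n
      ... | tri< m<n _ _ = ⊥-elim (distinct m<n p)
      ... | tri≈ _ m≡n _ = m≡n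
      ... | tri> _ _ n<m = ⊥-elim (distinct n<m (sym p))

  module _ {H : Graph ℓ} where
    open Graph H
    open Sequences vertexSetoid

    record LazyRay : Set ℓ where
      field
        at            : ℕ → V
        lazy          : ∀ n → (at n ~ at (suc n)) ⊎ (at n ≈ at (suc n))
        locallyFinite : LocallyFinite at

    ray⇒lazy : Ray H → LazyRay
    ray⇒lazy r = record
      { at            = at
      ; lazy          = inj₁ ∘ at-adj
      ; locallyFinite = injective⇒LocallyFinite distinct
      }
      where open Ray r

    infix 4 _≋_
    -- No finite vertex set separates the two.
    _≋_ : Rel LazyRay ℓ
    r ≋ s = ∀ F → Σ[ N ∈ ℕ ] (∀ m n → N ≤ m → N ≤ n → Walk (H ∖ᵛ F) (LazyRay.at r m) (LazyRay.at s n))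

    ≋-refl : ∀ {r} → r ≋ r
    ≋-refl {r} F = N , tail-walk at N λ n N≤n →
      h n N≤n ,
      (case lazy n of λ where
        (inj₁ a) → inj₁ (a , h n N≤n , h (suc n) (ℕₚ.m≤n⇒m≤1+n N≤n))
        (inj₂ p) → inj₂ p)
      where
      open LazyRay r
      N : ℕ
      N = proj₁ (eventually-∉ locallyFinite F)
      h : ∀ n → N ≤ n → at n ∉ F
      h = proj₂ (eventually-∉ locallyFinite F)

    ≋-sym : ∀ {r s} → r ≋ s → s ≋ r
    ≋-sym p F = let N , h = p F in N , λ m n N≤m N≤n → reverse (h n m N≤n N≤m)

    ≋-trans : ∀ {r s t} → r ≋ s → s ≋ t → r ≋ t
    ≋-trans p q F =
      let M , f = p F
          N , g = q F
          M≤ = ℕₚ.m≤m⊔n M N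
          N≤ = ℕₚ.m≤n⊔m M N
      in M ⊔ N , λ m n a b →
           f m (M ⊔ N) (ℕₚ.≤-trans M≤ a) M≤ ◅◅ g (M ⊔ N) n N≤ (ℕₚ.≤-trans N≤ b)

    contained-eventually : (s : Ray H) (w : LazyRay) → (∀ k → Σ[ m ∈ ℕ ] Ray.at s k ≈ LazyRay.at w m) →
                           ∀ N → Eventually (λ k → Σ[ m ∈ ℕ ] (N ≤ m × Ray.at s k ≈ LazyRay.at w m))
    contained-eventually s w s⊆w N =
      let K , g = eventually-∉ (LazyRay.locallyFinite (ray⇒lazy s)) (map (LazyRay.at w) (upTo N))
      in K , λ k K≤k →
        let m , p = s⊆w k
        in m , ℕₚ.≮⇒≥ (λ m<N → g k K≤k (Anyₚ.map⁺ (Any.map (λ { ≡.refl → p }) (Membership≡ₚ.∈-upTo⁺ m<N)))) , p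

    contained⇒≋ : (s : Ray H) (w : LazyRay) → (∀ k → Σ[ m ∈ ℕ ] Ray.at s k ≈ LazyRay.at w m) →
                  ray⇒lazy s ≋ w
    contained⇒≋ s w s⊆w F =
      let N , h = ≋-refl {w} F
          K , g = contained-eventually s w s⊆w N
      in K ⊔ N , λ k n K⊔N≤k K⊔N≤n →
        let m , N≤m , p = g k (ℕₚ.≤-trans (ℕₚ.m≤m⊔n K N) K⊔N≤k)
        in walk-respˡ (≈-sym p) (h m n N≤m (ℕₚ.≤-trans (ℕₚ.m≤n⊔m K N) K⊔N≤n))

    module _ (w : LazyRay) where
      private
        open LazyRay w

        last : ∀ n → Σ[ m ∈ ℕ ] (n ≤ m × at m ≈ at n × (∀ k → m < k → ¬ (at k ≈ at n)))
        last n = last-instance (λ k → at k ≈ at n) (locallyFinite (at n)) n ≈-refl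

        ι : ℕ → ℕ
        ι zero    = proj₁ (last 0)
        ι (suc k) = proj₁ (last (suc (ι k)))

        ι-next : ∀ k → at (ι (suc k)) ≈ at (suc (ι k))
        ι-next k = proj₁ (proj₂ (proj₂ (last (suc (ι k)))))

        ι-last : ∀ k l → ι k < l → ¬ (at l ≈ at (ι k))
        ι-last zero    l <l p = let _ , _ , q , h = last 0 in h l <l (≈-trans p q)
        ι-last (suc k) l <l p = let _ , _ , q , h = last (suc (ι k)) in h l <l (≈-trans p q)

        ι-step : ∀ k → ι k < ι (suc k)
        ι-step k = proj₁ (proj₂ (last (suc (ι k))))

        ι-mono : ∀ {k l} → k < l → ι k < ι l
        ι-mono {k} {suc l} (s≤s k≤l) with ℕₚ.m≤n⇒m<n∨m≡n k≤l
        ... | inj₁ k<l    = ℕₚ.<-trans (ι-mono k<l) (ι-step l)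
        ... | inj₂ ≡.refl = ι-step k

        ι-adj : ∀ k → at (ι k) ~ at (ι (suc k))
        ι-adj k with lazy (ι k)
        ... | inj₁ a = proj₁ ~-resp (≈-sym (ι-next k)) a
        ... | inj₂ p = ⊥-elim (ι-last k (suc (ι k)) ℕₚ.≤-refl (≈-sym p))

        ι-distinct : ∀ {k l} → at (ι k) ≈ at (ι l) → k ≡ l
        ι-distinct {k} {l} p with ℕₚ.<-cmp k l
        ... | tri< k<l _ _ = ⊥-elim (ι-last k (ι l) (ι-mono k<l) (≈-sym p))
        ... | tri≈ _ k≡l _ = k≡l
        ... | tri> _ _ l<k = ⊥-elim (ι-last l (ι k) (ι-mono l<k) p)

      containedRay : Ray H
      containedRay = record { at = at ∘ ι ; at-adj = ι-adj ; distinct = ι-distinct }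

      containedRay-⊆ : ∀ k → Σ[ m ∈ ℕ ]
        (Ray.at containedRay k ≈ at m × Ray.at containedRay (suc k) ≈ at (suc m))
      containedRay-⊆ k = ι k , ≈-refl , ι-next k

      containedRay-≋ : ray⇒lazy containedRay ≋ w
      containedRay-≋ = contained⇒≋ containedRay w λ k → ι k , ≈-refl

    private
      shorten : ∀ {S : Subgraph H} {x y} → Walk S x y →
                Σ[ x′ ∈ V ] Σ[ w ∈ Walk (whole H) x′ y ]
                  (x ≈ x′ × Unique (support w) × (∀ {z} → z ∈ support w → Subgraph.Vertex S z))
      shorten {S} {x} (stop v p) =
        x , stop _ p , ≈-refl , [] ∷ [] , λ { (here q) → Subgraph.Vertex-resp S (≈-sym q) v }
      shorten {S} {x} (step a w) with shorten w
      ... | y′ , w′ , y≈y′ , uniq , inS with em {x ∈ support w′}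
      ...   | no x∉ =
        x , step (proj₁ ~-resp y≈y′ (Subgraph.~⇒adj S a)) w′ , ≈-refl ,
        Membershipₚ.∉⇒All[≉] vertexSetoid x∉ ∷ uniq ,
        λ { (here q) → Subgraph.Vertex-resp S (≈-sym q) (Subgraph.~⇒Vertex S a) ; (there q) → inS q }
      ...   | yes x∈ = suffix w′ uniq inS x∈
        where
        suffix : ∀ {a b} (w : Walk (whole H) a b) → Unique (support w) →
                 (∀ {z} → z ∈ support w → Subgraph.Vertex S z) → x ∈ support w →
                 Σ[ x′ ∈ V ] Σ[ w′ ∈ Walk (whole H) x′ b ]
                   (x ≈ x′ × Unique (support w′) × (∀ {z} → z ∈ support w′ → Subgraph.Vertex S z))
        suffix w@(stop _ _) u i (here q)     = _ , w , q , u , i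
        suffix w@(step _ _) u i (here q)     = _ , w , q , u , i
        suffix (step _ w) (_ ∷ u) i (there q) = suffix w u (i ∘ there) q

    ≋⇒∼ : ∀ {r s} → ray⇒lazy r ≋ ray⇒lazy s → r ∼ s
    ≋⇒∼ {r} {s} r≋s = path , λ {m} {n} m≢n (v∈m , v∈n) → case ℕₚ.<-cmp m n of λ where
        (tri< m<n _ _) → avoids n v∈n (earlier m<n v∈m)
        (tri≈ _ m≡n _) → m≢n m≡n
        (tri> _ _ n<m) → avoids m v∈m (earlier n<m v∈n)
      where
      module _ (F : List V) where
        private
          N = proj₁ (r≋s F)
          w = shorten (proj₂ (r≋s F) N N ℕₚ.≤-refl ℕₚ.≤-refl)
        pathAvoiding : JoiningPath r s
        pathAvoiding = record
          { walk    = proj₁ (proj₂ w)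
          ; unique  = proj₁ (proj₂ (proj₂ (proj₂ w)))
          ; start∈r = N , ≈-sym (proj₁ (proj₂ (proj₂ w)))
          ; end∈s   = N , ≈-refl
          }
        pathAvoiding-∉ : ∀ {z} → z ∈ support (JoiningPath.walk pathAvoiding) → z ∉ F
        pathAvoiding-∉ = proj₂ (proj₂ (proj₂ (proj₂ w)))

      used : ℕ → List V
      path : ℕ → JoiningPath r s
      path n = pathAvoiding (used n)
      used zero    = []
      used (suc n) = support (JoiningPath.walk (path n)) ++ used n

      avoids : ∀ n {z} → z ∈ support (JoiningPath.walk (path n)) → z ∉ used n
      avoids n = pathAvoiding-∉ (used n)

      earlier : ∀ {m n z} → m < n → z ∈ support (JoiningPath.walk (path m)) → z ∈ used n
      earlier {m} {suc n} (s≤s m≤n) z∈ with ℕₚ.m≤n⇒m<n∨m≡n m≤n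
      ... | inj₁ m<n    = Membershipₚ.∈-++⁺ʳ vertexSetoid (support (JoiningPath.walk (path n))) (earlier m<n z∈)
      ... | inj₂ ≡.refl = Membershipₚ.∈-++⁺ˡ vertexSetoid z∈

    ∼⇒≋ : ∀ {r s} → r ∼ s → ray⇒lazy r ≋ ray⇒lazy s
    ∼⇒≋ {r} {s} (P , disj) F =
      let M , f = ≋-refl {ray⇒lazy r} F
          N , g = ≋-refl {ray⇒lazy s} F
          i , h = eventually-disjoint (F ++ map (Ray.at r) (upTo M) ++ map (Ray.at s) (upTo N))
          avoid : ∀ {v} → v ∈ support (JoiningPath.walk (P i)) →
                  v ∉ (F ++ map (Ray.at r) (upTo M) ++ map (Ray.at s) (upTo N))
          avoid v∈ v∈F = h i ℕₚ.≤-refl (v∈ , v∈F)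
          open JoiningPath (P i)
          a , start≈ = start∈r
          b , end≈   = end∈s
          M≤a = ℕₚ.≮⇒≥ λ a<M → avoid (start∈support walk)
                  (Membershipₚ.∈-++⁺ʳ vertexSetoid F (Membershipₚ.∈-++⁺ˡ vertexSetoid (initial r start≈ a<M)))
          N≤b = ℕₚ.≮⇒≥ λ b<N → avoid (end∈support walk)
                  (Membershipₚ.∈-++⁺ʳ vertexSetoid F (Membershipₚ.∈-++⁺ʳ vertexSetoid (map (Ray.at r) (upTo M)) (initial s end≈ b<N)))
          w   = within walk λ v∈ v∈F → avoid v∈ (Membershipₚ.∈-++⁺ˡ vertexSetoid v∈F)
      in M ⊔ N , λ m n M⊔N≤m M⊔N≤n →
           f m a (ℕₚ.≤-trans (ℕₚ.m≤m⊔n M N) M⊔N≤m) M≤a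
           ◅◅ walk-respˡ start≈ (walk-respʳ end≈ w)
           ◅◅ g b n N≤b (ℕₚ.≤-trans (ℕₚ.m≤n⊔m M N) M⊔N≤n)
      where
      initial : ∀ (t : Ray H) {x k K} → x ≈ Ray.at t k → k < K → x ∈ map (Ray.at t) (upTo K)
      initial t p k<K = Anyₚ.map⁺ (Any.map (λ { ≡.refl → p }) (Membership≡ₚ.∈-upTo⁺ k<K))

      eventually-disjoint : ∀ xs → Eventually (λ i → Disjoint (support (JoiningPath.walk (P i))) xs)
      eventually-disjoint [] = 0 , λ { _ _ (_ , ()) }
      eventually-disjoint (x ∷ xs) = Eventually-map
        (λ { (p , q) (v∈ , here e)  → p (Membershipₚ.∈-resp-≈ vertexSetoid e v∈)
           ; (p , q) (v∈ , there e) → q (v∈ , e) })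
        (Eventually-× misses (eventually-disjoint xs))
        where
        misses : Eventually (λ i → x ∉ support (JoiningPath.walk (P i)))
        misses with em {Σ[ i ∈ ℕ ] x ∈ support (JoiningPath.walk (P i))}
        ... | no none      = 0 , λ i _ x∈ → none (i , x∈)
        ... | yes (i , x∈) = suc i , λ j i<j x∈′ → disj (ℕₚ.<⇒≢ i<j) (x∈ , x∈′)

      within : ∀ {x y} (w : Walk (whole H) x y) → (∀ {v} → v ∈ support w → v ∉ F) → Walk (H ∖ᵛ F) x y
      within (stop _ p) h = stop (h (here ≈-refl)) p
      within (step a w) h = step (a , h (here ≈-refl) , h (there (start∈support w))) (within w (h ∘ there))

  Ω : Graph ℓ → Setoid ℓ ℓ
  Ω H = record
    { Carrier       = Ray H
    ; _≈_           = _∼_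
    ; isEquivalence = record
      { refl  = λ {r} → ≋⇒∼ (≋-refl {r = ray⇒lazy r})
      ; sym   = λ {r} {s} p → ≋⇒∼ (≋-sym {r = ray⇒lazy r} {ray⇒lazy s} (∼⇒≋ p))
      ; trans = λ {r} {s} {t} p q →
          ≋⇒∼ (≋-trans {r = ray⇒lazy r} {ray⇒lazy s} {ray⇒lazy t} (∼⇒≋ p) (∼⇒≋ q))
      }
    }

  module _ {H : Graph ℓ} where
    open Graph H

    end-component : ∀ (r : Ray H) F →
      Σ[ N ∈ ℕ ] (∀ m → N ≤ m → Ray.at r m ∉ F × tailComponent (H ∖ᵛ F) r ≐ Walk (H ∖ᵛ F) (Ray.at r m))
    end-component r F =
      let N , h = ≋-refl {r = ray⇒lazy r} F
      in N , λ m N≤m → walk-start (h m m N≤m N≤m) , tailComponent-≐ {r = r} N h m N≤m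

  module _ {H₁ H₂ : Graph ℓ} (ψ : ComplexMorphism H₁ H₂) (proper : StronglyProper ψ) where
    private
      module H₁ = Graph H₁
      module H₂ = Graph H₂
      module ψ = ComplexMorphism ψ

    image : Ray H₁ → LazyRay {H₂}
    image r = record
      { at            = ψ.to ∘ at
      ; lazy          = ψ.preserve ∘ at-adj
      ; locallyFinite = λ v →
          let F , h = proper v r
              N , g = end-component r F
          in N , λ n N≤n → h (proj₂ (proj₂ (g n N≤n)) (stop (proj₁ (g n N≤n)) H₁.≈-refl))
      }
      where open Ray r

    private
      avoiding : ∀ (r : Ray H₁) F₂ → Σ[ F₁ ∈ List H₁.V ]
                 (∀ {x} → tailComponent (H₁ ∖ᵛ F₁) r x → ψ.to x H₂.∉ F₂)
      avoiding r []       = [] , λ _ ()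
      avoiding r (y ∷ F₂) =
        let F  , h = proper y r
            F′ , h′ = avoiding r F₂
        in F ++ F′ , λ where
             t (here p)  → h (Eventually-map (Walk-∖ᵛ-antitone (Membershipₚ.∈-++⁺ˡ H₁.vertexSetoid)) t) p
             t (there p) → h′ (Eventually-map (Walk-∖ᵛ-antitone (Membershipₚ.∈-++⁺ʳ H₁.vertexSetoid F)) t) p

    image-≋ : ∀ {r s} → ray⇒lazy r ≋ ray⇒lazy s → image r ≋ image s
    image-≋ {r} {s} r≋s F₂ =
      let F₁ , av  = avoiding r F₂
          N₁ , g   = end-component r F₁
          N₂ , h   = r≋s F₁
      in N₁ ⊔ N₂ , λ m n N≤m N≤n →
        let _ , _ , ⊇ = g m (ℕₚ.≤-trans (ℕₚ.m≤m⊔n N₁ N₂) N≤m)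
            w = h m n (ℕₚ.≤-trans (ℕₚ.m≤n⊔m N₁ N₂) N≤m) (ℕₚ.≤-trans (ℕₚ.m≤n⊔m N₁ N₂) N≤n)
        in mapWalk ψ.to (tailComponent (H₁ ∖ᵛ F₁) r)
             (λ { (M , t) (a , x∉ , y∉) → M , λ k M≤k → t k M≤k ◅◅ step (a , x∉ , y∉) (stop y∉ H₁.≈-refl) })
             (λ t _ p → stop (av t) (ψ.cong p))
             (λ { t t′ (a , _) → case ψ.preserve a of λ where
                  (inj₁ b) → step (b , av t , av t′) (stop (av t′) H₂.≈-refl)
                  (inj₂ p) → stop (av t) p })
             (⊇ (stop (walk-start w) H₁.≈-refl)) w

    Ω-map : Func (Ω H₁) (Ω H₂)
    Ω-map = record
      { to   = containedRay ∘ image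
      ; cong = λ {r} {s} r∼s →
          let r′ = containedRay (image r)
              s′ = containedRay (image s)
          in ≋⇒∼ (≋-trans {r = ray⇒lazy r′} {image r} {ray⇒lazy s′} (containedRay-≋ (image r))
               (≋-trans {r = image r} {image s} {ray⇒lazy s′} (image-≋ {r} {s} (∼⇒≋ r∼s))
                 (≋-sym {r = ray⇒lazy s′} {image s} (containedRay-≋ (image s)))))
      }

    -- Any other ray contained in the image gives the same end.
    Ω-map-any : ∀ r s → (∀ k → Σ[ m ∈ ℕ ] Ray.at s k H₂.≈ ψ.to (Ray.at r m)) → Func.to Ω-map r ∼ s
    Ω-map-any r s s⊆ =
      let r′ = containedRay (image r)
      in ≋⇒∼ (≋-trans {r = ray⇒lazy r′} {image r} {ray⇒lazy s} (containedRay-≋ (image r))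
           (≋-sym {r = ray⇒lazy s} {image r} (contained⇒≋ s (image r) s⊆)))

  finite-⊆ : ∀ {S : Setoid ℓ ℓ} {P Q : Pred (Setoid.Carrier S) ℓ} → P ⊆ Q →
             Finiteness.Finite S Q → Finiteness.Finite S P
  finite-⊆ P⊆Q (xs , h) = xs , h ∘ P⊆Q

  finite-∪ : ∀ {S : Setoid ℓ ℓ} {P Q R : Pred (Setoid.Carrier S) ℓ} →
             (∀ {x} → R x → P x ⊎ Q x) →
             Finiteness.Finite S P → Finiteness.Finite S Q → Finiteness.Finite S R
  finite-∪ {S = S} split (xs , h) (ys , g) = xs ++ ys , λ r → case split r of λ where
    (inj₁ p) → Membershipₚ.∈-++⁺ˡ S (h p)
    (inj₂ q) → Membershipₚ.∈-++⁺ʳ S xs (g q)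

  ¬△⇒ : ∀ {X : Set ℓ} {A B : Pred X ℓ} {v} → ¬ (A △ B) v → A v → B v
  ¬△⇒ n a = dne λ ¬b → n (inj₁ (a , ¬b))

  ¬△⇐ : ∀ {X : Set ℓ} {A B : Pred X ℓ} {v} → ¬ (A △ B) v → B v → A v
  ¬△⇐ n b = dne λ ¬a → n (inj₂ (b , ¬a))

  module _ {G : Graph ℓ} where
    open Graph G
    private module L = Graph (LineGraph G)
    open Cut

    negligible-∪ : ∀ {A B C : Pred V ℓ} → (∀ {v} → ¬ A v → ¬ B v → ¬ C v) →
                   Negligible G A → Negligible G B → Negligible G C
    negligible-∪ {A} {B} {C} h (finA , degA) (finB , degB) =
      finite-∪ {S = vertexSetoid} split finA finB , λ c → [ degA , degB ]′ (split c)
      where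
      split : ∀ {v} → C v → A v ⊎ B v
      split {v} c with em {A v} | em {B v}
      ... | yes a | _     = inj₁ a
      ... | no ¬a | yes b = inj₂ b
      ... | no ¬a | no ¬b = ⊥-elim (h ¬a ¬b c)

    negligible-∅ : ∀ {A : Pred V ℓ} → (∀ {v} → ¬ A v) → Negligible G A
    negligible-∅ h = ([] , λ a → ⊥-elim (h a)) , λ a → ⊥-elim (h a)

    private
      cross-∪ : ∀ {A B C : Pred V ℓ} →
                (∀ {v w} → (A v → A w) → (A w → A v) → (B v → B w) → (B w → B v) → C v → C w) →
                ∀ {e} → Crosses G C e → Crosses G A e ⊎ Crosses G B e
      cross-∪ {A} {B} {C} h {e} c = dne λ none →
        let f : ∀ {P : Pred V ℓ} {v w} → ¬ (P v × ¬ P w) → P v → P w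
            f = λ n p → dne λ ¬q → n (p , ¬q)
            a→ = f {A} (none ∘ inj₁ ∘ inj₁)
            a← = f {A} (none ∘ inj₁ ∘ inj₂)
            b→ = f {B} (none ∘ inj₂ ∘ inj₁)
            b← = f {B} (none ∘ inj₂ ∘ inj₂)
        in case c of λ where
             (inj₁ (p , ¬q)) → ¬q (h a→ a← b→ b← p)
             (inj₂ (q , ¬p)) → ¬p (h a← a→ b← b→ q)

    infixr 7 _∩ᶜ_
    infixr 6 _∪ᶜ_

    _∩ᶜ_ _∪ᶜ_ : Cut G → Cut G → Cut G
    A ∩ᶜ B = record
      { set      = λ v → set A v × set B v
      ; set-resp = λ p (a , b) → set-resp A p a , set-resp B p b
      ; boundary = finite-∪ {S = edgeSetoid G}
          (λ {e} → cross-∪ {set A} {set B} {λ v → set A v × set B v} (λ a→ _ b→ _ (a , b) → a→ a , b→ b) {e}) (boundary A) (boundary B)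
      }
    A ∪ᶜ B = record
      { set      = λ v → set A v ⊎ set B v
      ; set-resp = λ p → [ inj₁ ∘ set-resp A p , inj₂ ∘ set-resp B p ]′
      ; boundary = finite-∪ {S = edgeSetoid G}
          (λ {e} → cross-∪ {set A} {set B} {λ v → set A v ⊎ set B v} (λ a→ _ b→ _ → [ inj₁ ∘ a→ , inj₂ ∘ b→ ]′) {e}) (boundary A) (boundary B)
      }

    ∁ᶜ : Cut G → Cut G
    ∁ᶜ A = record
      { set      = λ v → ¬ set A v
      ; set-resp = λ p ¬a a → ¬a (set-resp A (≈-sym p) a)
      ; boundary = finite-∪ {S = edgeSetoid G}
          (λ {e} → cross-∪ {set A} {set A} {λ v → ¬ set A v} (λ _ a← _ _ ¬a a → ¬a (a← a)) {e}) (boundary A) (boundary A)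
      }

    ∅ᶜ Vᶜ : Cut G
    ∅ᶜ = record
      { set      = λ _ → Lift ℓ ⊥
      ; set-resp = λ _ b → b
      ; boundary = [] , λ { (inj₁ (lift () , _)) ; (inj₂ (lift () , _)) }
      }
    Vᶜ = record
      { set      = λ _ → Lift ℓ ⊤
      ; set-resp = λ _ t → t
      ; boundary = [] , λ { (inj₁ (_ , n)) → ⊥-elim (n _) ; (inj₂ (_ , n)) → ⊥-elim (n _) }
      }

    infix 4 _≈ᶜ_
    _≈ᶜ_ : Rel (Cut G) ℓ
    A ≈ᶜ B = Negligible G (set A △ set B)

    ≐⇒≈ᶜ : ∀ {A B} → set A ≐ set B → A ≈ᶜ B
    ≐⇒≈ᶜ (A⊆B , B⊆A) = negligible-∅ λ where
      (inj₁ (a , ¬b)) → ¬b (A⊆B a)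
      (inj₂ (b , ¬a)) → ¬a (B⊆A b)

    ≈ᶜ-cong₂ : ∀ {A A′ B B′ C C′ : Cut G} →
               (∀ {v} → (set A v → set A′ v) → (set A′ v → set A v) →
                        (set B v → set B′ v) → (set B′ v → set B v) →
                        (set C v → set C′ v) × (set C′ v → set C v)) →
               A ≈ᶜ A′ → B ≈ᶜ B′ → C ≈ᶜ C′
    ≈ᶜ-cong₂ {A} {A′} {B} {B′} h = negligible-∪ λ ¬a ¬b →
      let f , g = h (¬△⇒ {A = set A} {set A′} ¬a) (¬△⇐ {A = set A} {set A′} ¬a)
                    (¬△⇒ {A = set B} {set B′} ¬b) (¬△⇐ {A = set B} {set B′} ¬b)
      in λ where
        (inj₁ (c , ¬c′)) → ¬c′ (f c)
        (inj₂ (c′ , ¬c)) → ¬c (g c′)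

  open Cut

  ℭ : Graph ℓ → BooleanAlgebra (lsuc ℓ) ℓ
  ℭ G = record
    { Carrier          = Cut G
    ; _≈_              = _≈ᶜ_
    ; _∨_              = _∪ᶜ_
    ; _∧_              = _∩ᶜ_
    ; ¬_               = ∁ᶜ
    ; ⊤                = Vᶜ
    ; ⊥                = ∅ᶜ
    ; isBooleanAlgebra = record
      { isDistributiveLattice = record
        { isLattice = record
          { isEquivalence = record
            { refl  = λ {A} → ≐⇒≈ᶜ {A = A} {A} (id , id)
            ; sym   = λ {A} {B} p → negligible-∪
                (λ n _ → λ { (inj₁ q) → n (inj₂ q) ; (inj₂ q) → n (inj₁ q) }) p p
            ; trans = λ {A} {B} {C} p q → ≈ᶜ-cong₂ {A = A} {B} {B} {C} {A} {C}
                (λ f f′ g g′ → g ∘ f , f′ ∘ g′) p q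
            }
          ; ∨-comm     = λ A B → ≐⇒≈ᶜ {A = A ∪ᶜ B} {B ∪ᶜ A} (swap , swap)
          ; ∨-assoc    = λ A B C → ≐⇒≈ᶜ {A = (A ∪ᶜ B) ∪ᶜ C} {A ∪ᶜ (B ∪ᶜ C)}
              ( [ [ inj₁ , inj₂ ∘ inj₁ ]′ , inj₂ ∘ inj₂ ]′
              , [ inj₁ ∘ inj₁ , [ inj₁ ∘ inj₂ , inj₂ ]′ ]′)
          ; ∨-cong     = λ {A} {A′} {B} {B′} → ≈ᶜ-cong₂ {A = A} {A′} {B} {B′} {A ∪ᶜ B} {A′ ∪ᶜ B′}
              λ a→ a← b→ b← → [ inj₁ ∘ a→ , inj₂ ∘ b→ ]′ , [ inj₁ ∘ a← , inj₂ ∘ b← ]′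
          ; ∧-comm     = λ A B → ≐⇒≈ᶜ {A = A ∩ᶜ B} {B ∩ᶜ A}
              ((λ (a , b) → b , a) , λ (b , a) → a , b)
          ; ∧-assoc    = λ A B C → ≐⇒≈ᶜ {A = (A ∩ᶜ B) ∩ᶜ C} {A ∩ᶜ (B ∩ᶜ C)}
              ((λ ((a , b) , c) → a , b , c) , λ (a , b , c) → (a , b) , c)
          ; ∧-cong     = λ {A} {A′} {B} {B′} → ≈ᶜ-cong₂ {A = A} {A′} {B} {B′} {A ∩ᶜ B} {A′ ∩ᶜ B′}
              λ a→ a← b→ b← → (λ (a , b) → a→ a , b→ b) , λ (a , b) → a← a , b← b
          ; absorptive =
              (λ A B → ≐⇒≈ᶜ {A = A ∪ᶜ (A ∩ᶜ B)} {A} ([ id , proj₁ ]′ , inj₁)) ,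
              (λ A B → ≐⇒≈ᶜ {A = A ∩ᶜ (A ∪ᶜ B)} {A} (proj₁ , λ a → a , inj₁ a))
          }
        ; ∨-distrib-∧ =
            (λ A B C → ≐⇒≈ᶜ {A = A ∪ᶜ (B ∩ᶜ C)} {(A ∪ᶜ B) ∩ᶜ (A ∪ᶜ C)} (∪-∩ , ∩-∪)) ,
            (λ A B C → ≐⇒≈ᶜ {A = (B ∩ᶜ C) ∪ᶜ A} {(B ∪ᶜ A) ∩ᶜ (C ∪ᶜ A)}
              ( (λ p → let q , r = ∪-∩ (swap p) in swap q , swap r)
              , λ (q , r) → swap (∩-∪ (swap q , swap r))))
        ; ∧-distrib-∨ =
            (λ A B C → ≐⇒≈ᶜ {A = A ∩ᶜ (B ∪ᶜ C)} {(A ∩ᶜ B) ∪ᶜ (A ∩ᶜ C)}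
              ( (λ (a , p) → [ (λ b → inj₁ (a , b)) , (λ c → inj₂ (a , c)) ]′ p)
              , [ (λ (a , b) → a , inj₁ b) , (λ (a , c) → a , inj₂ c) ]′)) ,
            (λ A B C → ≐⇒≈ᶜ {A = (B ∪ᶜ C) ∩ᶜ A} {(B ∩ᶜ A) ∪ᶜ (C ∩ᶜ A)}
              ( (λ (p , a) → [ (λ b → inj₁ (b , a)) , (λ c → inj₂ (c , a)) ]′ p)
              , [ (λ (b , a) → inj₁ b , a) , (λ (c , a) → inj₂ c , a) ]′))
        }
      ; ∨-complement =
          (λ A → ≐⇒≈ᶜ {A = ∁ᶜ A ∪ᶜ A} {Vᶜ} (_ , λ _ → swap (decide A))) ,
          (λ A → ≐⇒≈ᶜ {A = A ∪ᶜ ∁ᶜ A} {Vᶜ} (_ , λ _ → decide A))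
      ; ∧-complement =
          (λ A → ≐⇒≈ᶜ {A = ∁ᶜ A ∩ᶜ A} {∅ᶜ} ((λ (n , a) → ⊥-elim (n a)) , λ ())) ,
          (λ A → ≐⇒≈ᶜ {A = A ∩ᶜ ∁ᶜ A} {∅ᶜ} ((λ (a , n) → ⊥-elim (n a)) , λ ()))
      ; ¬-cong = λ {A} {B} p → ≈ᶜ-cong₂ {A = A} {B} {A} {B} {∁ᶜ A} {∁ᶜ B}
          (λ f g _ _ → (λ n → n ∘ g) , (λ n → n ∘ f)) p p
      }
    }
    where
    ∪-∩ : ∀ {A B C : Set ℓ} → A ⊎ (B × C) → (A ⊎ B) × (A ⊎ C)
    ∪-∩ (inj₁ a)       = inj₁ a , inj₁ a
    ∪-∩ (inj₂ (b , c)) = inj₂ b , inj₂ c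
    ∩-∪ : ∀ {A B C : Set ℓ} → (A ⊎ B) × (A ⊎ C) → A ⊎ (B × C)
    ∩-∪ (inj₁ a , _)      = inj₁ a
    ∩-∪ (inj₂ b , inj₁ a) = inj₁ a
    ∩-∪ (inj₂ b , inj₂ c) = inj₂ (b , c)
    decide : ∀ (A : Cut G) {v} → set A v ⊎ ¬ set A v
    decide A {v} with em {set A v}
    ... | yes a = inj₁ a
    ... | no ¬a = inj₂ ¬a

  module _ {G₁ G₂ : Graph ℓ} (conn : Connected G₁) (φ : Hom G₁ G₂) (proper : StronglyLineProper φ) where
    private
      module G₁ = Graph G₁
      module G₂ = Graph G₂
      module L₁ = Graph (LineGraph G₁)
      module L₂ = Graph (LineGraph G₂)
      module φ = Hom φ
      Lφ : Edge G₁ → Edge G₂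
      Lφ = Func.to (lineFunc φ)

      Lφ-incident : ∀ {v e} → _∈ᵉ_ G₁ v e → _∈ᵉ_ G₂ (φ.to v) (Lφ e)
      Lφ-incident (at-src p) = at-src (φ.cong p)
      Lφ-incident (at-tgt p) = at-tgt (φ.cong p)

    preimage-finite : ∀ (P : Pred (Edge G₂) ℓ) → L₂.Finite P → L₁.Finite (P ∘ Lφ)
    preimage-finite P (es , P⊆es) = let fs , h = go es in fs , h ∘ P⊆es
      where
      go : ∀ es → L₁.Finite (λ f → Lφ f L₂.∈ es)
      go []       = [] , λ ()
      go (e ∷ es) = finite-∪ {S = edgeSetoid G₁}
        (λ { (here p) → inj₁ p ; (there p) → inj₂ p }) (proper e) (go es)

    private
      endpoints-∈ : ∀ {v fs} → (Σ[ e ∈ Edge G₁ ] _∈ᵉ_ G₁ v e) →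
                    (∀ {e} → _∈ᵉ_ G₁ v e → e L₁.∈ fs) → v G₁.∈ endpoints fs
      endpoints-∈ (e , v∈e) h = ∈-endpoints (h v∈e) v∈e

      fibre-finite : ∀ w → FiniteDegree G₂ w → G₁.Finite (λ v → φ.to v G₂.≈ w)
      fibre-finite w fd =
        let fs , h = preimage-finite (_∈ᵉ_ G₂ w) fd
            inc : ∀ {v} → φ.to v G₂.≈ w → ∀ {e} → _∈ᵉ_ G₁ v e → e L₁.∈ fs
            inc = λ p v∈e → h (∈ᵉ-respˡ G₂ p (Lφ-incident v∈e))
        in case em {Σ[ v ∈ G₁.V ] (∀ e → ¬ _∈ᵉ_ G₁ v e)} of λ where
          -- An isolated vertex of a connected graph is the only vertex.
          (yes (v , isolated)) → v ∷ [] , λ {x} _ → case conn x v of λ where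
             w → here (only isolated (reverse w))
          (no none) → endpoints fs , λ {v} p →
            endpoints-∈ (dne λ n → none (v , λ e v∈e → n (e , v∈e))) (inc p)
        where
        only : ∀ {v x} → (∀ e → ¬ _∈ᵉ_ G₁ v e) → Walk (whole G₁) v x → x G₁.≈ v
        only isolated (stop _ p) = G₁.≈-sym p
        only isolated (step a _) = ⊥-elim (isolated (edge a) (at-src G₁.≈-refl))

    preimage-negligible : ∀ {D : Pred G₂.V ℓ} → Negligible G₂ D → Negligible G₁ (D ∘ φ.to)
    preimage-negligible {D} ((ws , D⊆ws) , deg) =
      (let xs , h = go ws in xs , λ d → h (D⊆ws d , d)) ,
      λ {v} d → let fs , h = preimage-finite (_∈ᵉ_ G₂ (φ.to v)) (deg d) in fs , h ∘ Lφ-incident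
      where
      go : ∀ ws → G₁.Finite (λ v → φ.to v G₂.∈ ws × D (φ.to v))
      go []       = [] , λ { (() , _) }
      go (w ∷ ws) = finite-∪ {S = G₁.vertexSetoid} {P = λ v → φ.to v G₂.≈ w × D (φ.to v)}
        (λ { (here p , d) → inj₁ (p , d) ; (there p , d) → inj₂ (p , d) }) fst (go ws)
        where
        fst : G₁.Finite (λ v → φ.to v G₂.≈ w × D (φ.to v))
        fst with em {Σ[ v ∈ G₁.V ] (φ.to v G₂.≈ w × D (φ.to v))}
        ... | no none          = [] , λ {v} pd → ⊥-elim (none (v , pd))
        ... | yes (v , p , d) =
          let es , h = deg d
              xs , g = fibre-finite w (es , λ w∈e → h (∈ᵉ-respˡ G₂ (G₂.≈-sym p) w∈e))
          in xs , g ∘ proj₁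

    ℭ-map : BooleanHom (ℭ G₂) (ℭ G₁)
    ℭ-map = record
      { ⟦_⟧ = λ A → record
        { set      = set A ∘ φ.to
        ; set-resp = set-resp A ∘ φ.cong
        ; boundary = preimage-finite (Crosses G₂ (set A)) (boundary A)
        }
      ; isLatticeHomomorphism = record
        { isRelHomomorphism = record { cong = preimage-negligible }
        ; ∧-homo            = λ _ _ → negligible-∅ λ { (inj₁ (a , ¬a)) → ¬a a ; (inj₂ (a , ¬a)) → ¬a a }
        ; ∨-homo            = λ _ _ → negligible-∅ λ { (inj₁ (a , ¬a)) → ¬a a ; (inj₂ (a , ¬a)) → ¬a a }
        }
      ; ¬-homo = λ _ → negligible-∅ λ { (inj₁ (a , ¬a)) → ¬a a ; (inj₂ (a , ¬a)) → ¬a a }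
      ; ⊤-homo = negligible-∅ λ { (inj₁ (a , ¬a)) → ¬a a ; (inj₂ (a , ¬a)) → ¬a a }
      ; ⊥-homo = negligible-∅ λ { (inj₁ (a , ¬a)) → ¬a a ; (inj₂ (a , ¬a)) → ¬a a }
      }

  module _ {G : Graph ℓ} where
    open Graph G
    private
      module L = Graph (LineGraph G)
      module Seqᵛ = Sequences vertexSetoid
      module Seqᵉ = Sequences (edgeSetoid G)

      edgesBetween : V → V → List (Edge G)
      edgesBetween x y with em {x ~ y}
      ... | yes a = edge a ∷ []
      ... | no _  = []

      edgesWithin : List V → List (Edge G)
      edgesWithin xs = concatMap (λ x → concatMap (edgesBetween x) xs) xs

      ∈-edgesBetween : ∀ {x y} (e : Edge G) → Edge.src e ≈ x → Edge.tgt e ≈ y → e L.∈ edgesBetween x y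
      ∈-edgesBetween {x} {y} e p q with em {x ~ y}
      ... | yes _ = here (same p q)
      ... | no ¬a = ⊥-elim (¬a (proj₁ ~-resp q (proj₂ ~-resp p (Edge.adj e))))

    finite-edges : ∀ {C : Pred V ℓ} → Finite C →
                   L.Finite (λ e → C (Edge.src e) × C (Edge.tgt e))
    finite-edges (xs , h) = edgesWithin xs , λ {e} (c , d) →
      Anyₚ.concatMap⁺ _ (Any.map
        (λ p → Anyₚ.concatMap⁺ _ (Any.map (∈-edgesBetween e p) (h d))) (h c))

    edge-walk : ∀ {F e x y} → e L.∉ F → _∈ᵉ_ G x e → _∈ᵉ_ G y e → Walk (G ∖ᵉ F) x y
    edge-walk {F} {e} e∉F (at-src p) (at-src q) = stop _ (≈-trans p (≈-sym q))
    edge-walk {F} {e} e∉F (at-tgt p) (at-tgt q) = stop _ (≈-trans p (≈-sym q))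
    edge-walk {F} {e} e∉F (at-src p) (at-tgt q) =
      walk-respˡ (≈-sym p) (step (Edge.adj e , e∉F) (stop _ (≈-sym q)))
    edge-walk {F} {e} e∉F (at-tgt p) (at-src q) =
      walk-respˡ (≈-sym p) (step (Subgraph.~-sym (G ∖ᵉ F) (Edge.adj e , e∉F)) (stop _ (≈-sym q)))

    finite-component⇒FiniteDegree : ∀ {F v} → Finite (Walk (G ∖ᵉ F) v) → FiniteDegree G v
    finite-component⇒FiniteDegree {F} {v} fin = finite-∪ {S = edgeSetoid G}
      {P = λ e → e L.∈ F} {Q = λ e → Walk (G ∖ᵉ F) v (Edge.src e) × Walk (G ∖ᵉ F) v (Edge.tgt e)}
      (λ {e} v∈e → case em {e L.∈ F} of λ where
        (yes e∈F) → inj₁ e∈F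
        (no e∉F)  → inj₂ (edge-walk e∉F v∈e (at-src ≈-refl) , edge-walk e∉F v∈e (at-tgt ≈-refl)))
      (F , id) (finite-edges fin)

    ρ-vertex : (v : V) → InfiniteDegree G v → Direction G
    ρ-vertex v inf = record
      { comp        = λ F → Walk (G ∖ᵉ F) v
      ; isComponent = λ F → walk-component _
      ; isInfinite  = λ F fin → inf (finite-component⇒FiniteDegree fin)
      ; monotone    = λ F⊆F′ → Walk-∖ᵉ-antitone F⊆F′
      }

    edgeRay : Ray G → Ray (LineGraph G)
    edgeRay r = record
      { at       = λ n → edge (at-adj n)
      ; at-adj   = λ n → (λ { (same p _) → ℕₚ.m≢1+m+n n {0} (≡.trans (distinct p) (≡.cong suc (≡.sym (ℕₚ.+-identityʳ n))))
                            ; (flip p _) → ℕₚ.m≢1+m+n n {1} (≡.trans (distinct p) (≡.cong suc (ℕₚ.+-comm 1 n))) })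
                         , at (suc n) , at-tgt ≈-refl , at-src ≈-refl
      ; distinct = λ { {m} {n} (same p _) → distinct p
                     ; {m} {n} (flip p q) → ⊥-elim (ℕₚ.m≢1+m+n m {1}
                         (≡.trans (distinct p) (≡.cong suc (≡.trans (≡.sym (distinct q)) (ℕₚ.+-comm 1 m))))) }
      }
      where open Ray r

    ray-eventually-connected : ∀ (r : Ray G) F →
      Σ[ N ∈ ℕ ] (∀ m n → N ≤ m → N ≤ n → Walk (G ∖ᵉ F) (Ray.at r m) (Ray.at r n))
    ray-eventually-connected r F =
      let N , h = Seqᵉ.eventually-∉ (Seqᵉ.injective⇒LocallyFinite (Ray.distinct (edgeRay r))) F
      in N , tail-walk (Ray.at r) N λ n N≤n → _ , inj₁ (Ray.at-adj r n , h n N≤n)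

    ρ-ray : Ray G → Direction G
    ρ-ray r = record
      { comp        = λ F → tailComponent (G ∖ᵉ F) r
      ; isComponent = λ F → let N , h = ray-eventually-connected r F
                            in at N , _ , tailComponent-≐ {r = r} N h N ℕₚ.≤-refl
      ; isInfinite  = λ F → let N , h = ray-eventually-connected r F
                            in Seqᵛ.eventually-infinite (Seqᵛ.injective⇒LocallyFinite distinct)
                                 (N , λ n N≤n → N , λ m N≤m → h m n N≤m N≤n)
      ; monotone    = λ F⊆F′ → Eventually-map (Walk-∖ᵉ-antitone F⊆F′)
      }
      where open Ray r

  module _ (G : Graph ℓ) (conn : Connected G) where
    open Graph G
    open Ultrafilter
    open Direction
    private
      module L = Graph (LineGraph G)
      module ℭ = BooleanAlgebra (ℭ G)

    -- The component of x in G ∖ᵉ F, as a cut.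
    componentCut : List (Edge G) → V → Cut G
    componentCut F x = record
      { set      = Walk (G ∖ᵉ F) x
      ; set-resp = walk-respʳ
      ; boundary = F , λ { {e} c → dne λ e∉F → case c of λ where
          (inj₁ (w , ¬w)) → ¬w (w ◅◅ edge-walk e∉F (at-src ≈-refl) (at-tgt ≈-refl))
          (inj₂ (w , ¬w)) → ¬w (w ◅◅ edge-walk e∉F (at-tgt ≈-refl) (at-src ≈-refl)) }
      }

    -- Components of G ∖ᵉ F do not cross a cut whose boundary lies in F.
    walk-within : ∀ (A : Cut G) {F} → (∀ {e} → Crosses G (set A) e → e L.∈ F) →
                  ∀ {x y} → Walk (G ∖ᵉ F) x y → set A x → set A y
    walk-within A h (stop _ p)         a = set-resp A p a
    walk-within A h (step (b , e∉F) w) a =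
      walk-within A h w (dne λ ¬a → e∉F (h (inj₁ (a , ¬a))))

    private
      representatives : ∀ F → Σ[ xs ∈ List V ] (∀ y → Any (λ x → Walk (G ∖ᵉ F) x y) xs)
      representatives F with em {V}
      ... | no ¬v = [] , λ y → ⊥-elim (¬v y)
      ... | yes z = z ∷ endpoints F , λ y → go (conn y z)
        where
        go : ∀ {y} → Walk (whole G) y z → Any (λ x → Walk (G ∖ᵉ F) x y) (z ∷ endpoints F)
        go (stop _ p) = here (stop _ (≈-sym p))
        go {y} (step {y = y′} a w) with em {edge a L.∈ F}
        ... | yes a∈F = there (Any.map (λ p → stop _ (≈-sym p)) (∈-endpoints a∈F (at-src ≈-refl)))
        ... | no a∉F  = Any.map (_◅◅ edge-walk a∉F (at-tgt ≈-refl) (at-src ≈-refl)) (go w)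

      meet : List (Edge G) → List V → Cut G
      meet F []       = Vᶜ
      meet F (x ∷ xs) = ∁ᶜ (componentCut F x) ∩ᶜ meet F xs

      meet-∌ : ∀ {F y} xs → set (meet F xs) y → ¬ Any (λ x → Walk (G ∖ᵉ F) x y) xs
      meet-∌ (x ∷ xs) (n , _) (here w)  = n w
      meet-∌ (x ∷ xs) (_ , m) (there w) = meet-∌ xs m w

      resp : ∀ (u : Ultrafilter (ℭ G)) {A B} → A ≈ᶜ B → mem u A → mem u B
      resp = mem-resp {B₁ = ℭ G}

    mem-⊆ : ∀ (u : Ultrafilter (ℭ G)) {A B} → set A ⊆ set B → mem u A → mem u B
    mem-⊆ u {A} {B} A⊆B = up-closed u (≐⇒≈ᶜ {A = A ∩ᶜ B} {A} (proj₁ , λ a → a , A⊆B a))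

    mem-nonempty : ∀ (u : Ultrafilter (ℭ G)) {A} → mem u A → Σ[ x ∈ V ] set A x
    mem-nonempty u {A} m = dne λ none →
      𝟘-nonmem u (resp u {A} {∅ᶜ} (≐⇒≈ᶜ {A = A} {∅ᶜ} ((λ {x} a → ⊥-elim (none (x , a))) , λ ())) m)

    component-of : ∀ (u : Ultrafilter (ℭ G)) F → Σ[ x ∈ V ] mem u (componentCut F x)
    component-of u F = let xs , h = representatives F in case go xs of λ where
        (inj₁ found) → found
        (inj₂ m)     → let y , a = mem-nonempty u {meet F xs} m in ⊥-elim (meet-∌ xs a (h y))
      where
      go : ∀ xs → (Σ[ x ∈ V ] mem u (componentCut F x)) ⊎ mem u (meet F xs)
      go []       = inj₂ (𝟙-mem u)
      go (x ∷ xs) with ultra u (componentCut F x) | go xs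
      ... | inj₁ m | _          = inj₁ (x , m)
      ... | inj₂ _ | inj₁ found = inj₁ found
      ... | inj₂ n | inj₂ m     = inj₂ (∧-closed u n m)

    private
      meets : ∀ (u : Ultrafilter (ℭ G)) {A B} → mem u A → mem u B → Σ[ x ∈ V ] (set A x × set B x)
      meets u {A} {B} m n = mem-nonempty u {A ∩ᶜ B} (∧-closed u m n)

    component-unique : ∀ (u : Ultrafilter (ℭ G)) F {x y} →
                       mem u (componentCut F x) → mem u (componentCut F y) → Walk (G ∖ᵉ F) x y
    component-unique u F {x} {y} m n =
      let z , xz , yz = meets u {componentCut F x} {componentCut F y} m n in xz ◅◅ reverse yz

    ρ-ult : Ultrafilter (ℭ G) → Direction G
    ρ-ult u = record
      { comp        = λ F → Walk (G ∖ᵉ F) (proj₁ (component-of u F))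
      ; isComponent = λ F → walk-component _
      ; isInfinite  = λ F fin →
          let x , m = component-of u F
          in 𝟘-nonmem u (resp u {componentCut F x} {∅ᶜ}
               (negligible-∪ {G = G} {A = Walk (G ∖ᵉ F) x} {B = λ _ → Lift ℓ ⊥}
                 (λ { ¬a _ (inj₁ (a , _)) → ¬a a ; _ _ (inj₂ (lift () , _)) })
                 (fin , λ w → finite-component⇒FiniteDegree
                   (finite-⊆ {S = vertexSetoid} (w ◅◅_) fin))
                 (negligible-∅ {G = G} λ ()))
               m)
      ; monotone    = λ {F} {F′} F⊆F′ w →
          let x  , m  = component-of u F
              x′ , m′ = component-of u F′
              y , p , q = meets u {componentCut F x} {componentCut F′ x′} m m′
          in p ◅◅ Walk-∖ᵉ-antitone F⊆F′ (reverse q ◅◅ w)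
      }

    private
      ++ˡ : ∀ {F F′ : List (Edge G)} {e} → e L.∈ F → e L.∈ F ++ F′
      ++ˡ = Membershipₚ.∈-++⁺ˡ (edgeSetoid G)

      ++ʳ : ∀ F {F′ : List (Edge G)} {e} → e L.∈ F′ → e L.∈ F ++ F′
      ++ʳ F = Membershipₚ.∈-++⁺ʳ (edgeSetoid G) F

    inhabitant : ∀ (ρ : Direction G) F → Σ[ x ∈ V ] comp ρ F x
    inhabitant ρ F = component-inhabited (isComponent ρ F)

    avoids-FiniteDegree : ∀ (ρ : Direction G) {v} → FiniteDegree G v →
                          Σ[ F ∈ List (Edge G) ] ¬ comp ρ F v
    avoids-FiniteDegree ρ {v} (F , h) = F , λ c →
      isInfinite ρ F (v ∷ [] , λ d → here (≈-sym (only (component-walk (isComponent ρ F) c d))))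
      where
      only : ∀ {x} → Walk (G ∖ᵉ F) v x → v ≈ x
      only (stop _ p)         = p
      only (step (a , a∉F) _) = ⊥-elim (a∉F (h (at-src ≈-refl)))

    avoids-list : ∀ (ρ : Direction G) xs → (∀ {x} → x ∈ xs → Σ[ F ∈ List (Edge G) ] ¬ comp ρ F x) →
                  Σ[ F ∈ List (Edge G) ] (∀ {x} → comp ρ F x → x ∉ xs)
    avoids-list ρ []       h = [] , λ _ ()
    avoids-list ρ (x ∷ xs) h =
      let F  , n = h (here ≈-refl)
          F′ , m = avoids-list ρ xs (h ∘ there)
      in F ++ F′ , λ where
        c (here p)  → n (component-closed (isComponent ρ F) (monotone ρ ++ˡ c) (stop _ p))
        c (there p) → m (monotone ρ (++ʳ F) c) p

    ult-ρ : Direction G → Ultrafilter (ℭ G)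
    ult-ρ ρ = record
      { mem       = λ A → Σ[ F ∈ List (Edge G) ] comp ρ F ⊆ set A
      ; 𝟙-mem     = [] , _
      ; 𝟘-nonmem  = λ (F , h) → case h (proj₂ (inhabitant ρ F)) of λ ()
      ; ∧-closed  = λ (F , h) (F′ , h′) →
          F ++ F′ , λ c → h (monotone ρ ++ˡ c) , h′ (monotone ρ (++ʳ F) c)
      ; up-closed = λ {A} {B} ((fin , deg)) (F , h) →
          let xs , D⊆xs = fin
              F′ , av = avoids-list ρ (proj₁ (finite-part A B fin deg))
                          (λ x∈ → avoids-FiniteDegree ρ (proj₂ (finite-part A B fin deg) x∈))
          in F ++ F′ , λ {y} c → dne λ ¬b →
               av (monotone ρ (++ʳ F) c) (covered A B fin deg (inj₂ (h (monotone ρ ++ˡ c) , λ (_ , b) → ¬b b)))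
      ; ultra     = λ A →
          let ∂ , h = boundary A
              x , c = inhabitant ρ ∂
          in case em {set A x} of λ where
            (yes a) → inj₁ (∂ , λ {_} d → walk-within A h (component-walk (isComponent ρ ∂) c d) a)
            (no ¬a) → inj₂ (∂ , λ {_} d b → ¬a (walk-within A h (component-walk (isComponent ρ ∂) d c) b))
      }
      where
      module _ (A B : Cut G) (fin : Finite (set (A ∩ᶜ B) △ set A))
               (deg : ∀ {v} → (set (A ∩ᶜ B) △ set A) v → FiniteDegree G v) where
        D : Pred V ℓ
        D = set (A ∩ᶜ B) △ set A

        fd-resp : ∀ {v w} → v ≈ w → FiniteDegree G v → FiniteDegree G w
        fd-resp p (es , h) = es , λ w∈e → h (∈ᵉ-respˡ G (≈-sym p) w∈e)

        keep : ∀ xs → Σ[ ys ∈ List V ] ((∀ {x} → x ∈ ys → FiniteDegree G x) × (∀ {x} → D x → x ∈ xs → x ∈ ys))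
        keep []       = [] , (λ ()) , λ _ ()
        keep (x ∷ xs) with keep xs | em {FiniteDegree G x}
        ... | ys , f , g | yes fd = x ∷ ys ,
          (λ { (here p) → fd-resp (≈-sym p) fd ; (there p) → f p }) ,
          (λ { d (here p) → here p ; d (there p) → there (g d p) })
        ... | ys , f , g | no ¬fd = ys , f ,
          (λ { d (here p) → ⊥-elim (¬fd (fd-resp p (deg d))) ; d (there p) → g d p })

        finite-part : Σ[ ys ∈ List V ] (∀ {x} → x ∈ ys → FiniteDegree G x)
        finite-part = proj₁ (keep (proj₁ fin)) , proj₁ (proj₂ (keep (proj₁ fin)))

        covered : ∀ {x} → D x → x ∈ proj₁ finite-part
        covered d = proj₂ (proj₂ (keep (proj₁ fin))) d (proj₂ fin d)

    ultIso : Inverse (Ult (ℭ G)) (𝒟ᴱ G)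
    ultIso = record
      { to        = ρ-ult
      ; from      = ult-ρ
      ; to-cong   = λ {u} {u′} → to-cong {u} {u′}
      ; from-cong = λ {ρ} {ρ′} → from-cong {ρ} {ρ′}
      ; inverse   =
          (λ {ρ} {u} p F →
            let q = to-cong {u} {ult-ρ ρ} p F
                r = to∘from ρ F
            in proj₁ r ∘ proj₁ q , proj₂ q ∘ proj₂ r) ,
          (λ {u} {ρ} p →
            let q = from-cong {ρ} {ρ-ult u} p
                r = from∘to u
            in (λ {A} → proj₁ r ∘ proj₁ q {A}) , (λ {A} → proj₂ q {A} ∘ proj₂ r))
      }
      where
      to-cong : ∀ {u u′} → mem u ≐ mem u′ → ∀ F → comp (ρ-ult u) F ≐ comp (ρ-ult u′) F
      to-cong {u} {u′} (p , q) F =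
        let x  , m  = component-of u F
            x′ , m′ = component-of u′ F
            w = component-unique u′ F (p {componentCut F x} m) m′
        in (reverse w ◅◅_) , (w ◅◅_)

      from-cong : ∀ {ρ ρ′} → (∀ F → comp ρ F ≐ comp ρ′ F) → mem (ult-ρ ρ) ≐ mem (ult-ρ ρ′)
      from-cong p = (λ (F , h) → F , h ∘ proj₂ (p F)) , (λ (F , h) → F , h ∘ proj₁ (p F))

      to∘from : ∀ ρ F → comp (ρ-ult (ult-ρ ρ)) F ≐ comp ρ F
      to∘from ρ F =
        let x , F′ , h = component-of (ult-ρ ρ) F
            z , c = inhabitant ρ (F ++ F′)
        in components-≐ (walk-component _) (isComponent ρ F)
             (h (monotone ρ (++ʳ F) c)) (monotone ρ ++ˡ c)

      from∘to : ∀ u → mem (ult-ρ (ρ-ult u)) ≐ mem u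
      from∘to u =
        (λ { {A} (F , h) → mem-⊆ u {componentCut F (proj₁ (component-of u F))} {A} h (proj₂ (component-of u F)) }) ,
        (λ {A} m →
          let ∂ , h = boundary A
              x , n = component-of u ∂
              y , a , w = meets u {A} {componentCut ∂ x} m n
          in ∂ , λ v → walk-within A h (reverse w ◅◅ v) a)

  module _ {G : Graph ℓ} where
    open Graph G
    open Direction
    private
      module L = Graph (LineGraph G)
      module Seqᵉ = Sequences (edgeSetoid G)

    touching : ∀ {F e f x} → e L.∉ F → f L.∉ F → _∈ᵉ_ G x e → _∈ᵉ_ G x f → Walk (LineGraph G ∖ᵛ F) e f
    touching {e = e} {f} {x} e∉F f∉F x∈e x∈f with em {e L.≈ f}
    ... | yes p = stop e∉F p
    ... | no ¬p = step ((¬p , x , x∈e , x∈f) , e∉F , f∉F) (stop f∉F L.≈-refl)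

    line-walk⇒walk : ∀ {F e f x y} → Walk (LineGraph G ∖ᵛ F) e f → _∈ᵉ_ G x e → _∈ᵉ_ G y f → Walk (G ∖ᵉ F) x y
    line-walk⇒walk (stop e∉F p) x∈e y∈f = edge-walk e∉F x∈e (∈ᵉ-respʳ G (L.≈-sym p) y∈f)
    line-walk⇒walk (step ((_ , v , v∈e , v∈e′) , e∉F , _) w) x∈e y∈f =
      edge-walk e∉F x∈e v∈e ◅◅ line-walk⇒walk w v∈e′ y∈f

    walk⇒line-walk : ∀ {F e x y} → Walk (G ∖ᵉ F) x y → _∈ᵉ_ G x e → e L.∉ F →
                     Σ[ f ∈ Edge G ] (Walk (LineGraph G ∖ᵛ F) e f × _∈ᵉ_ G y f)
    walk⇒line-walk (stop _ p) x∈e e∉F = _ , stop e∉F L.≈-refl , ∈ᵉ-respˡ G p x∈e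
    walk⇒line-walk (step (a , a∉F) w) x∈e e∉F =
      let f , v , y∈f = walk⇒line-walk w (at-tgt ≈-refl) a∉F
      in f , touching e∉F a∉F x∈e (at-src ≈-refl) ◅◅ v , y∈f

    tailComponent-∉ : ∀ {F} (r : Ray (LineGraph G)) {e} → tailComponent (LineGraph G ∖ᵛ F) r e → e L.∉ F
    tailComponent-∉ r (N , h) = walk-end (h N ℕₚ.≤-refl)

    ρ-end : Ray (LineGraph G) → Direction G
    ρ-end r = record
      { comp        = λ F x → Σ[ e ∈ Edge G ] (tailComponent (LineGraph G ∖ᵛ F) r e × _∈ᵉ_ G x e)
      ; isComponent = λ F →
          let N , h = end-component r F
              N∉F , ⊆ , ⊇ = h N ℕₚ.≤-refl
          in Edge.src (at N) , _ ,
             (λ (f , t , x∈f) → line-walk⇒walk (⊆ t) (at-src ≈-refl) x∈f) ,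
             (λ w → let f , v , x∈f = walk⇒line-walk w (at-src ≈-refl) N∉F in f , ⊇ v , x∈f)
      ; isInfinite  = λ F fin →
          let N , h = end-component r F
              t : ∀ n → N ≤ n → tailComponent (LineGraph G ∖ᵛ F) r (at n)
              t n N≤n = proj₂ (proj₂ (h n N≤n)) (stop (proj₁ (h n N≤n)) L.≈-refl)
          in Seqᵉ.eventually-infinite (Seqᵉ.injective⇒LocallyFinite distinct)
               (N , λ n N≤n → (at n , t n N≤n , at-src ≈-refl) , (at n , t n N≤n , at-tgt ≈-refl))
               (finite-edges fin)
      ; monotone    = λ F⊆F′ (e , t , x∈e) → e , Eventually-map (Walk-∖ᵛ-antitone F⊆F′) t , x∈e
      }
      where open Ray r

    -- The edge set of ρ-end r at F is the component of LineGraph G ∖ᵛ F containing a tail of r.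
    ρ-end-edges : ∀ r F {e x} → e L.∉ F → _∈ᵉ_ G x e → comp (ρ-end r) F x →
                  tailComponent (LineGraph G ∖ᵛ F) r e
    ρ-end-edges r F e∉F x∈e (f , t , x∈f) =
      Eventually-map (λ w → w ◅◅ touching (tailComponent-∉ r t) e∉F x∈f x∈e) t

    tailComponent-cong : ∀ {r s : Ray (LineGraph G)} → r ∼ s →
                         ∀ {F} → tailComponent (LineGraph G ∖ᵛ F) r ⊆ tailComponent (LineGraph G ∖ᵛ F) s
    tailComponent-cong {r} {s} r∼s {F} (M , t) =
      let N , h = ∼⇒≋ r∼s F
      in N , λ n N≤n → reverse (h (M ⊔ N) n (ℕₚ.m≤n⊔m M N) N≤n) ◅◅ t (M ⊔ N) (ℕₚ.m≤m⊔n M N)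

  module _ (G : Graph ℓ) (conn : Connected G) where
    open Graph G
    open Direction
    private
      module L = Graph (LineGraph G)
      module Seqᵛ = Sequences vertexSetoid
      module Seqᵉ = Sequences (edgeSetoid G)
      ++ˡ : ∀ {F F′ : List (Edge G)} {e} → e L.∈ F → e L.∈ F ++ F′
      ++ˡ = Membershipₚ.∈-++⁺ˡ (edgeSetoid G)

      ++ʳ : ∀ F {F′ : List (Edge G)} {e} → e L.∈ F′ → e L.∈ F ++ F′
      ++ʳ F = Membershipₚ.∈-++⁺ʳ (edgeSetoid G) F

    private
      module Dominated (ρ : Direction G) (v : V) (v∈ρ : ∀ F → comp ρ F v) where
        infinite : InfiniteDegree G v
        infinite fd = let F , n = avoids-FiniteDegree G conn ρ fd in n (v∈ρ F)

        star : Σ[ w ∈ (ℕ → Edge G) ] ((∀ n → _∈ᵉ_ G v (w n)) × (∀ {m n} → w m L.≈ w n → m ≡ n))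
        star = Seqᵉ.enumerate infinite

        ray : Ray (LineGraph G)
        ray = record
          { at       = proj₁ star
          ; at-adj   = λ n → (λ p → ℕₚ.1+n≢n (≡.sym (proj₂ (proj₂ star) p))) ,
                             v , proj₁ (proj₂ star) n , proj₁ (proj₂ star) (suc n)
          ; distinct = proj₂ (proj₂ star)
          }

        ray-direction : ∀ F → comp (ρ-end ray) F ≐ comp ρ F
        ray-direction F =
          let N , h = end-component ray F
              N∉F , _ , ⊇ = h N ℕₚ.≤-refl
          in components-≐ (isComponent (ρ-end ray) F) (isComponent ρ F)
               (_ , ⊇ (stop N∉F L.≈-refl) , proj₁ (proj₂ star) N) (v∈ρ F)

      module Undominated (ρ : Direction G) (avoid : ∀ v → Σ[ F ∈ List (Edge G) ] ¬ comp ρ F v) where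
        x₀ : V
        x₀ = proj₁ (inhabitant G conn ρ [])

        next-avoiding : ∀ F → Σ[ F′ ∈ List (Edge G) ] (∀ {x} → comp ρ F′ x → x ∉ endpoints {G = G} F)
        next-avoiding F = avoids-list G conn ρ (endpoints {G = G} F) (λ {x} _ → avoid x)

        Fs : ℕ → List (Edge G)
        Fs zero    = proj₁ (avoid x₀)
        Fs (suc n) = Fs n ++ proj₁ (next-avoiding (Fs n))

        C : ℕ → Pred V ℓ
        C n = comp ρ (Fs n)

        C-comp : ∀ n → IsComponent (G ∖ᵉ Fs n) (C n)
        C-comp n = isComponent ρ (Fs n)

        C-step : ∀ n → C (suc n) ⊆ C n
        C-step n = monotone ρ ++ˡ

        C-anti : ∀ {m n} → m ≤ n → C n ⊆ C m
        C-anti {m} {n} m≤n c with ℕₚ.m≤n⇒m<n∨m≡n m≤n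
        ... | inj₂ ≡.refl = c
        C-anti {m} {suc n} _ c | inj₁ (s≤s m≤n) = C-anti m≤n (C-step n c)

        C-endpoints : ∀ n {x} → C (suc n) x → x ∉ endpoints {G = G} (Fs n)
        C-endpoints n c = proj₂ (next-avoiding (Fs n)) (monotone ρ {proj₁ (next-avoiding (Fs n))} {Fs (suc n)} (++ʳ (Fs n)) c)

        escape : ∀ v → Σ[ n ∈ ℕ ] ¬ C n v
        escape v = go (conn x₀ v) (0 , proj₂ (avoid x₀))
          where
          go : ∀ {x y} → Walk (whole G) x y → Σ[ n ∈ ℕ ] ¬ C n x → Σ[ n ∈ ℕ ] ¬ C n y
          go (stop _ p) (n , ¬c) = n , λ c → ¬c (component-closed (C-comp n) c (stop _ (≈-sym p)))
          go (step {y = y} a w) (n , ¬c) with em {C n y}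
          ... | no ¬c′ = go w (n , ¬c′)
          ... | yes c  = go w (suc n , λ c′ → C-endpoints n c′ (∈-endpoints {e = edge a}
                  (dne λ a∉F → ¬c (component-closed (C-comp n) c (edge-walk a∉F (at-tgt ≈-refl) (at-src ≈-refl))))
                  (at-tgt ≈-refl)))

        escape-list : ∀ xs → Σ[ n ∈ ℕ ] (∀ {x} → C n x → x ∉ xs)
        escape-list []       = 0 , λ _ ()
        escape-list (x ∷ xs) =
          let m , p = escape x
              n , q = escape-list xs
          in m ⊔ n , λ where
            c (here e)  → p (component-closed (C-comp m) (C-anti (ℕₚ.m≤m⊔n m n) c) (stop _ e))
            c (there e) → q (C-anti (ℕₚ.m≤n⊔m m n) c) e

        C⊆ρ : ∀ F → Σ[ n ∈ ℕ ] C n ⊆ comp ρ F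
        C⊆ρ F =
          let n , out = escape-list (endpoints {G = G} F)
              z , c = inhabitant G conn ρ (F ++ Fs n)
              zC = monotone ρ (++ʳ F) c
          in n , λ {y} yC → component-closed (isComponent ρ F) (monotone ρ ++ˡ c)
               (mapWalk id (C n)
                 (λ c a → component-closed (C-comp n) c (step a (stop _ ≈-refl)))
                 (λ _ _ p → stop _ p)
                 (λ { cx _ (a , _) → edge-walk {e = edge a} (λ a∈F → out cx (∈-endpoints a∈F (at-src ≈-refl)))
                                       (at-src ≈-refl) (at-tgt ≈-refl) })
                 zC (component-walk (C-comp n) zC yC))

        xs : ℕ → V
        xs n = proj₁ (inhabitant G conn ρ (Fs n))

        xs∈C : ∀ n → C n (xs n)
        xs∈C n = proj₂ (inhabitant G conn ρ (Fs n))

        -- Concatenating walks xs n → xs (suc n) inside C n: the current stage,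
        -- the current vertex and what remains of the current walk.
        State : Set ℓ
        State = Σ[ n ∈ ℕ ] Σ[ y ∈ V ] Walk (G ∖ᵉ Fs n) y (xs (suc n))

        stage : State → ℕ
        stage = proj₁

        pos : State → V
        pos = proj₁ ∘ proj₂

        begin : ∀ n → State
        begin n = n , xs n , component-walk (C-comp n) (xs∈C n) (C-step n (xs∈C (suc n)))

        next : State → State
        next (n , y , stop _ _)         = begin (suc n)
        next (n , y , step {y = z} _ w) = n , z , w

        state : ℕ → State
        state zero    = begin 0
        state (suc t) = next (state t)

        next-lazy : ∀ s → (pos s ~ pos (next s)) ⊎ (pos s ≈ pos (next s))
        next-lazy (n , y , stop _ p)       = inj₂ p
        next-lazy (n , y , step (a , _) _) = inj₁ a

        next-stage : ∀ s → stage s ≤ stage (next s)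
        next-stage (n , y , stop _ _) = ℕₚ.n≤1+n n
        next-stage (n , y , step _ _) = ℕₚ.≤-refl

        pos∈C : ∀ s → C (stage s) (pos s)
        pos∈C (n , y , w) = component-closed (C-comp n) (C-step n (xs∈C (suc n))) (reverse w)

        stage-mono : ∀ {t t′} → t ≤ t′ → stage (state t) ≤ stage (state t′)
        stage-mono {t} {t′} t≤t′ with ℕₚ.m≤n⇒m<n∨m≡n t≤t′
        ... | inj₂ ≡.refl = ℕₚ.≤-refl
        stage-mono {t} {suc t′} _ | inj₁ (s≤s t≤t′) = ℕₚ.≤-trans (stage-mono t≤t′) (next-stage (state t′))

        finish : ∀ {n y} (w : Walk (G ∖ᵉ Fs n) y (xs (suc n))) t → state t ≡ (n , y , w) →
                 Σ[ t′ ∈ ℕ ] stage (state t′) ≡ suc n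
        finish (stop _ _) t eq = suc t , ≡.cong (stage ∘ next) eq
        finish {n} (step {y = z} _ w) t eq = finish {n} {z} w (suc t) (≡.cong next eq)

        reach : ∀ k → Σ[ t ∈ ℕ ] k ≤ stage (state t)
        reach zero    = 0 , z≤n
        reach (suc k) =
          let t  , k≤ = reach k
              t′ , eq = finish (proj₂ (proj₂ (state t))) t ≡.refl
          in t′ , ℕₚ.≤-trans (s≤s k≤) (ℕₚ.≤-reflexive (≡.sym eq))

        eventually-C : ∀ k → Eventually (λ t → C k (pos (state t)))
        eventually-C k = let t , k≤ = reach k in
          t , λ t′ t≤t′ → C-anti (ℕₚ.≤-trans k≤ (stage-mono t≤t′)) (pos∈C (state t′))

        walk : LazyRay {G}
        walk = record
          { at            = pos ∘ state
          ; lazy          = next-lazy ∘ state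
          ; locallyFinite = λ v → let n , ¬c = escape v in
              Eventually-map (λ c p → ¬c (component-closed (C-comp n) c (stop _ p))) (eventually-C n)
          }

        vertexRay : Ray G
        vertexRay = containedRay walk

        ray : Ray (LineGraph G)
        ray = edgeRay vertexRay

        eventually-ρ : ∀ F → Eventually (λ k → comp ρ F (Ray.at vertexRay k))
        eventually-ρ F =
          let n , C⊆ = C⊆ρ F
              T , h = eventually-C n
          in Eventually-map
               (λ (m , T≤m , p) → component-closed (isComponent ρ F) (C⊆ (h m T≤m)) (stop _ (≈-sym p)))
               (contained-eventually vertexRay walk
                 (λ k → let m , p , _ = containedRay-⊆ walk k in m , p) T)

        ray-direction : ∀ F → comp (ρ-end ray) F ≐ comp ρ F
        ray-direction F =
          let N , h = Eventually-× (end-component ray F) (eventually-ρ F)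
              (N∉F , _ , ⊇) , c = h N ℕₚ.≤-refl
          in components-≐ (isComponent (ρ-end ray) F) (isComponent ρ F)
               (_ , ⊇ (stop N∉F L.≈-refl) , at-src ≈-refl) c

    ρ-end-injective : ∀ {r s} → (∀ F → comp (ρ-end r) F ≐ comp (ρ-end s) F) → r ∼ s
    ρ-end-injective {r} {s} p = ≋⇒∼ λ F →
      let x , c = inhabitant G conn (ρ-end r) F
          e , (M , t) , x∈e = c
          f , (N , t′) , x∈f = proj₁ (p F) c
          w = touching (tailComponent-∉ r (M , t)) (tailComponent-∉ s (N , t′)) x∈e x∈f
      in M ⊔ N , λ m n M⊔N≤m M⊔N≤n →
           t m (ℕₚ.≤-trans (ℕₚ.m≤m⊔n M N) M⊔N≤m) ◅◅ w
           ◅◅ reverse (t′ n (ℕₚ.≤-trans (ℕₚ.m≤n⊔m M N) M⊔N≤n))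

    ρ-end-surjective : ∀ ρ → Σ[ r ∈ Ray (LineGraph G) ] (∀ F → comp (ρ-end r) F ≐ comp ρ F)
    ρ-end-surjective ρ with em {Σ[ v ∈ V ] (∀ F → comp ρ F v)}
    ... | yes (v , v∈ρ) = let open Dominated ρ v v∈ρ in ray , ray-direction
    ... | no none       = let open Undominated ρ (λ v → ¬∀⟶∃¬ λ v∈ρ → none (v , v∈ρ)) in ray , ray-direction

    ρ-end-cong : ∀ {r s} → r ∼ s → ∀ F → comp (ρ-end r) F ≐ comp (ρ-end s) F
    ρ-end-cong {r} {s} p F =
      (λ (e , t , x∈e) → e , tailComponent-cong p t , x∈e) ,
      (λ (e , t , x∈e) → e , tailComponent-cong (Setoid.sym (Ω (LineGraph G)) {r} {s} p) t , x∈e)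

    endIso : Inverse (Ω (LineGraph G)) (𝒟ᴱ G)
    endIso = Bijection⇒Inverse record
      { to        = ρ-end
      ; cong      = ρ-end-cong
      ; bijective = ρ-end-injective , λ ρ →
          let r , p = ρ-end-surjective ρ
          in r , λ {s} s∼r F →
               let q = ρ-end-cong {s} {r} s∼r F
               in proj₁ (p F) ∘ proj₁ q , proj₂ q ∘ proj₂ (p F)
      }

  module _ {G₁ G₂ : Graph ℓ} (φ : Hom G₁ G₂) where
    private
      module L₁ = Graph (LineGraph G₁)
      module L₂ = Graph (LineGraph G₂)
      module φ = Hom φ

    lineMorphism : ComplexMorphism (LineGraph G₁) (LineGraph G₂)
    lineMorphism = record { func = lineFunc φ ; preserve = preserve }
      where
      to : Edge G₁ → Edge G₂
      to = Func.to (lineFunc φ)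
      incident : ∀ {v e} → _∈ᵉ_ G₁ v e → _∈ᵉ_ G₂ (φ.to v) (to e)
      incident (at-src p) = at-src (φ.cong p)
      incident (at-tgt p) = at-tgt (φ.cong p)
      preserve : ∀ {e f} → e L₁.~ f → to e L₂.~ to f ⊎ to e L₂.≈ to f
      preserve {e} {f} (_ , v , v∈e , v∈f) with em {to e L₂.≈ to f}
      ... | yes p = inj₂ p
      ... | no ¬p = inj₁ (¬p , φ.to v , incident v∈e , incident v∈f)

    lineMorphism-stronglyProper : StronglyLineProper φ → StronglyProper lineMorphism
    lineMorphism-stronglyProper proper f r =
      let F , h = proper f
      in F , λ (N , t) p → walk-end (t N ℕₚ.≤-refl) (h p)

  module _ {G₁ G₂ : Graph ℓ} (conn₁ : Connected G₁) (conn₂ : Connected G₂)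
           (φ : Hom G₁ G₂) (proper : StronglyLineProper φ) where

    private
      module α₁ = Inverse (ultIso G₁ conn₁)
      module α₂ = Inverse (ultIso G₂ conn₂)
      module β₁ = Inverse (endIso G₁ conn₁)
      module β₂ = Inverse (endIso G₂ conn₂)
      module Uφ = Func (Ult-map (ℭ-map conn₁ φ proper))
      module Ωφ = Func (Ω-map (lineMorphism φ) (lineMorphism-stronglyProper φ proper))

    𝒟ᴱ-via-Ult 𝒟ᴱ-via-Ω : Func (𝒟ᴱ G₁) (𝒟ᴱ G₂)
    𝒟ᴱ-via-Ult = record
      { to   = λ ρ → α₂.to (Uφ.to (α₁.from ρ))
      ; cong = λ {ρ} {ρ′} p →
          α₂.to-cong {Uφ.to (α₁.from ρ)} {Uφ.to (α₁.from ρ′)}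
            (Uφ.cong {α₁.from ρ} {α₁.from ρ′} (α₁.from-cong {ρ} {ρ′} p))
      }
    𝒟ᴱ-via-Ω = record
      { to   = λ ρ → β₂.to (Ωφ.to (β₁.from ρ))
      ; cong = λ {ρ} {ρ′} p →
          β₂.to-cong {Ωφ.to (β₁.from ρ)} {Ωφ.to (β₁.from ρ′)}
            (Ωφ.cong {β₁.from ρ} {β₁.from ρ′} (β₁.from-cong {ρ} {ρ′} p))
      }

{-# OPTIONS --safe #-}
module Submission where

-- For every finite F ⊂ E(G₂), the set φ⁻¹(𝒟ᴱ(φ)(ρ)(F)) contains ρ(F′) for some
-- finite F′ ⊂ E(G₁). As the components of G₂ ∖ᵉ F are disjoint, each equality of
-- directions amounts to finding, for every F, a vertex of φ(ρ(F′)) in the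
-- component chosen by the other direction.

open import Defs
open import Axiom.ExcludedMiddle using (ExcludedMiddle)
open import Data.List.Base using (List)
open import Data.Nat.Base using (ℕ; _+_; _≤_; _⊔_)
open import Data.Product.Base using (Σ-syntax; _×_; _,_; proj₁; proj₂)
open import Data.Sum.Base using (inj₁)
open import Function.Base using (_∘_)
open import Function.Bundles using (Func; Inverse)
open import Relation.Binary.Bundles using (Setoid)
open import Relation.Unary using (_⊆_)

import Data.Nat.Properties as ℕₚ

module _ {ℓ} (em : ExcludedMiddle ℓ) where
  open Classical em
  open Direction

  private
    Lφ : ∀ {G₁ G₂ : Graph ℓ} → Hom G₁ G₂ → Edge G₁ → Edge G₂
    Lφ φ = Func.to (lineFunc φ)

    Lφ-incident : ∀ {G₁ G₂ : Graph ℓ} (φ : Hom G₁ G₂) {v e} →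
                  _∈ᵉ_ G₁ v e → _∈ᵉ_ G₂ (Hom.to φ v) (Lφ φ e)
    Lφ-incident φ (at-src p) = at-src (Hom.cong φ p)
    Lφ-incident φ (at-tgt p) = at-tgt (Hom.cong φ p)

  ρ-end-eventually : ∀ {G : Graph ℓ} (r : Ray (LineGraph G)) F →
                     Eventually (λ n → comp (ρ-end r) F (Edge.src (Ray.at r n)))
  ρ-end-eventually {G} r F =
    let N , h = end-component r F
    in N , λ n N≤n → let n∉F , _ , ⊇ = h n N≤n in
         _ , ⊇ (stop n∉F (≈ᵉ-refl G)) , at-src (Graph.≈-refl G)

  module _ {G₁ G₂ : Graph ℓ} (conn₁ : Connected G₁) (conn₂ : Connected G₂)
           (φ : Hom G₁ G₂) (proper : StronglyLineProper φ) where
    private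
      module G₁ = Graph G₁
      module G₂ = Graph G₂
      module L₂ = Graph (LineGraph G₂)
      module φ = Hom φ
      module β₁ = Inverse (endIso G₁ conn₁)

      ψ : ComplexMorphism (LineGraph G₁) (LineGraph G₂)
      ψ = lineMorphism φ

      ψ-proper : StronglyProper ψ
      ψ-proper = lineMorphism-stronglyProper φ proper

      𝒟ᴱφ 𝒟ᴱφ-Ω : Direction G₁ → Direction G₂
      𝒟ᴱφ   = Func.to (𝒟ᴱ-via-Ult conn₁ conn₂ φ proper)
      𝒟ᴱφ-Ω = Func.to (𝒟ᴱ-via-Ω conn₁ conn₂ φ proper)

    -- Edges at `v` go to edges at `φ.to v`, and a finite set of edges of `G₂` has only finitely
    -- many preimages.
    InfiniteDegree-image : ∀ {v} → InfiniteDegree G₁ v → InfiniteDegree G₂ (φ.to v)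
    InfiniteDegree-image {v} inf fd =
      let fs , h = preimage-finite conn₁ φ proper (_∈ᵉ_ G₂ (φ.to v)) fd
      in inf (fs , h ∘ Lφ-incident φ)

    -- The image of `r` may repeat vertices and need not be a ray. But the edges of `r` are distinct
    -- and only finitely many edges of `G₁` map into `F`, so the image walk eventually avoids `F`.
    image-ray-connected : ∀ (r : Ray G₁) F → Σ[ N ∈ ℕ ]
      (∀ m n → N ≤ m → N ≤ n → Walk (G₂ ∖ᵉ F) (φ.to (Ray.at r m)) (φ.to (Ray.at r n)))
    image-ray-connected r F =
      let F′ , φ⁻¹F⊆F′ = preimage-finite conn₁ φ proper (L₂._∈ F) (F , λ e∈F → e∈F)
          N , h = eventually-∉ (injective⇒LocallyFinite (Ray.distinct (edgeRay r))) F′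
      in N , tail-walk (φ.to ∘ Ray.at r) N λ n N≤n →
           _ , inj₁ (φ.preserve (Ray.at-adj r n) , h n N≤n ∘ φ⁻¹F⊆F′)
      where open Sequences (edgeSetoid G₁)

    -- Holds by unfolding: a cut lies in the pushed-forward ultrafilter when its preimage contains
    -- some `comp ρ F′`, and the component chosen at `F` is such a cut.
    𝒟ᴱ-via-Ult-preimage : ∀ ρ F → Σ[ F′ ∈ List (Edge G₁) ] comp ρ F′ ⊆ comp (𝒟ᴱφ ρ) F ∘ φ.to
    𝒟ᴱ-via-Ult-preimage ρ F =
      proj₂ (component-of G₂ conn₂ (Func.to (Ult-map (ℭ-map conn₁ φ proper)) (ult-ρ G₁ conn₁ ρ)) F)

    -- The ray representing the image end is not separated from the image of `r` by any finite set
    -- of edges, so its tail component at `F` contains almost all edges of that image.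
    ρ-end-image : ∀ (r : Ray (LineGraph G₁)) F →
      Eventually (λ n → comp (ρ-end (Func.to (Ω-map ψ ψ-proper) r)) F (φ.to (Edge.src (Ray.at r n))))
    ρ-end-image r F =
      let N , h = containedRay-≋ (image ψ ψ-proper r) F
      in N , λ n N≤n → Lφ φ (Ray.at r n) , (N , λ m N≤m → h m n N≤m N≤n) , at-src G₂.≈-refl

    via-Ult≈via-Ω : ∀ ρ → Setoid._≈_ (𝒟ᴱ G₂) (𝒟ᴱφ ρ) (𝒟ᴱφ-Ω ρ)
    via-Ult≈via-Ω ρ F =
      let r = β₁.from ρ
          F′ , F′⊆ = 𝒟ᴱ-via-Ult-preimage ρ F
          N , h = Eventually-× (ρ-end-eventually r F′) (ρ-end-image r F)
          p , q = h N ℕₚ.≤-refl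
      -- The common vertex is the image of the source of the `N`-th edge of `r`; `p` carries over to
      -- `ρ` because `r` represents `ρ`.
      in components-≐ (isComponent (𝒟ᴱφ ρ) F) (isComponent (𝒟ᴱφ-Ω ρ) F)
           (F′⊆ (proj₁ (β₁.strictlyInverseˡ ρ F′) p)) q

    𝒟ᴱ-ρ-vertex : ∀ v (inf : InfiniteDegree G₁ v) →
      Setoid._≈_ (𝒟ᴱ G₂) (𝒟ᴱφ (ρ-vertex v inf)) (ρ-vertex (φ.to v) (InfiniteDegree-image inf))
    𝒟ᴱ-ρ-vertex v inf F =
      let F′ , F′⊆ = 𝒟ᴱ-via-Ult-preimage (ρ-vertex v inf) F
      in components-≐ (isComponent (𝒟ᴱφ (ρ-vertex v inf)) F) (walk-component _)
           (F′⊆ (stop _ G₁.≈-refl)) (stop _ G₂.≈-refl)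

    𝒟ᴱ-ρ-ray-eventually : ∀ r F → Eventually (λ n → comp (𝒟ᴱφ (ρ-ray r)) F (φ.to (Ray.at r n)))
    𝒟ᴱ-ρ-ray-eventually r F =
      let F′ , F′⊆ = 𝒟ᴱ-via-Ult-preimage (ρ-ray r) F
          N , h = ray-eventually-connected r F′
      in N , λ n N≤n → F′⊆ (N , λ m N≤m → h m n N≤m N≤n)

    𝒟ᴱ-ρ-ray-intersects : ∀ r k → AlwaysIntersects (φ.to ∘ Ray.at (drop k r)) (𝒟ᴱφ (ρ-ray r))
    𝒟ᴱ-ρ-ray-intersects r k F =
      -- Index `N` of the tail `drop k r` is index `k + N` of `r`.
      let N , h = 𝒟ᴱ-ρ-ray-eventually r F in N , h (k + N) (ℕₚ.m≤n+m N k)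

    𝒟ᴱ-ρ-ray-unique : ∀ r ρ → (∀ k → AlwaysIntersects (φ.to ∘ Ray.at (drop k r)) ρ) →
                      Setoid._≈_ (𝒟ᴱ G₂) ρ (𝒟ᴱφ (ρ-ray r))
    𝒟ᴱ-ρ-ray-unique r ρ meets F =
      let M , f = image-ray-connected r F
          N , g = 𝒟ᴱ-ρ-ray-eventually r F
          -- Applying the hypothesis to the tail from `M` puts the meeting vertex at index `M + n`,
          -- where the image walk no longer uses `F`. It can then be followed inside the component
          -- to `M ⊔ N`, a vertex common to both directions.
          n , c = meets M F
          M≤ = ℕₚ.m≤m⊔n M N
      in components-≐ (isComponent ρ F) (isComponent (𝒟ᴱφ (ρ-ray r)) F)
           (component-closed (isComponent ρ F) c (f (M + n) (M ⊔ N) (ℕₚ.m≤m+n M n) M≤))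
           (g (M ⊔ N) (ℕₚ.m≤n⊔m M N))

proposition24 :
  ∀ {ℓ} (em : ExcludedMiddle ℓ) →
  let open Classical em in
  ∀ {G₁ G₂ : Graph ℓ} (conn₁ : Connected G₁) (conn₂ : Connected G₂)
    (φ : Hom G₁ G₂) (proper : StronglyLineProper φ) →
  let open Setoid (𝒟ᴱ G₂) using (_≈_)
      open Hom φ using () renaming (to to φ₀)
      𝒟ᴱφ   = Func.to (𝒟ᴱ-via-Ult conn₁ conn₂ φ proper)
      𝒟ᴱφ-Ω = Func.to (𝒟ᴱ-via-Ω conn₁ conn₂ φ proper)
  in
  (∀ ρ → 𝒟ᴱφ ρ ≈ 𝒟ᴱφ-Ω ρ)
  × (∀ v (inf₁ : InfiniteDegree G₁ v) →
       Σ[ inf₂ ∈ InfiniteDegree G₂ (φ₀ v) ]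
         𝒟ᴱφ (ρ-vertex v inf₁) ≈ ρ-vertex (φ₀ v) inf₂)
  × (∀ (r : Ray G₁) →
       (∀ k → AlwaysIntersects (φ₀ ∘ Ray.at (drop k r)) (𝒟ᴱφ (ρ-ray r)))
       × (∀ ρ′ → (∀ k → AlwaysIntersects (φ₀ ∘ Ray.at (drop k r)) ρ′) →
            ρ′ ≈ 𝒟ᴱφ (ρ-ray r)))
proposition24 em conn₁ conn₂ φ proper =
  via-Ult≈via-Ω em conn₁ conn₂ φ proper ,
  (λ v inf₁ → InfiniteDegree-image em conn₁ conn₂ φ proper inf₁ ,
              𝒟ᴱ-ρ-vertex em conn₁ conn₂ φ proper v inf₁) ,
  (λ r → 𝒟ᴱ-ρ-ray-intersects em conn₁ conn₂ φ proper r ,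
         𝒟ᴱ-ρ-ray-unique em conn₁ conn₂ φ proper r)
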